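{- Let $m \in \mathbb{N}$ and consider $CGG(2m)$. A set $C$ of edges of $CGG(2m)$ is a co-blocker if and only if $C$ is a perfect matching of $CGG(2m)$ such that: (i) every edge of $C$ has odd order; and (ii) whenever $[a,b]$ and $[a',c]$ are two edges of $C$ such that $a$ and $a'$ are adjacent vertices of $P$ (i.e. $[a,a']$ is a boundary edge of $P$), the edges $[a,b]$ and $[a',c]$ do not cross (do not intersect in a point interior to both segments).
   Context: $CGG(2m)$ denotes the complete convex geometric graph on $2m$ vertices: its vertex set $V$ is the vertex set of a convex $2m$-gon $P$ in the plane, labelled cyclically $0,1,\dots,2m-1$, and its edges are all $\binom{2m}{2}$ closed straight-line segments joining pairs of vertices (boundary edges of $P$ and diagonals). The order of an edge $[i,j]$ is $\min(|j-i|,2m-|j-i|)$; boundary edges have order $1$. A perfect matching of $CGG(2m)$ is a set of $m$ edges such that every vertex lies in exactly one of them (edges may cross). A simple perfect matching (SPM) is a set of $m$ pairwise disjoint edges (not intersecting even in an interior point). Two sets of edges meet if they have an edge in common. A blocker is a set of edges of $CGG(2m)$ of minimum cardinality among all sets of edges that meet every SPM. A co-blocker is a set of edges of $CGG(2m)$ of minimum cardinality among all sets of edges that meet every blocker. -}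

module Defs where

open import Data.Nat using (ℕ; zero; suc; _*_; _∸_; _⊓_; _%_)
open import Data.Fin using (Fin; toℕ; _<_)
open import Data.List using (List; length)
open import Data.List.Membership.Propositional using (_∈_)
open import Data.List.Relation.Unary.Unique.Propositional using (Unique)
open import Data.List.Relation.Unary.AllPairs using (AllPairs)
open import Data.Product using (Σ; _×_; ∃)
open import Data.Sum using (_⊎_)
open import Relation.Binary.PropositionalEquality using (_≡_)
open import Relation.Nullary using (¬_)
open import Data.Nat using () renaming (_≤_ to _≤ℕ_)

-- Vertices of CGG(n) are Fin n, labelled cyclically around the convex polygon.
-- An edge [i,j] is stored with its endpoints in increasing label order.
record Edge (n : ℕ) : Set where
  constructor edge
  field
    lo  : Fin n
    hi  : Fin n
    lo<hi : lo < hi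
open Edge public

order : ∀ {n} → Edge n → ℕ
order {n} e = (toℕ (hi e) ∸ toℕ (lo e)) ⊓ (n ∸ (toℕ (hi e) ∸ toℕ (lo e)))

OddOrder : ∀ {n} → Edge n → Set
OddOrder e = order e % 2 ≡ 1

Incident : ∀ {n} → Fin n → Edge n → Set
Incident v e = (lo e ≡ v) ⊎ (hi e ≡ v)

Joins : ∀ {n} → Edge n → Fin n → Fin n → Set
Joins e x y = (lo e ≡ x × hi e ≡ y) ⊎ (lo e ≡ y × hi e ≡ x)

ShareVertex : ∀ {n} → Edge n → Edge n → Set
ShareVertex e f = ∃ λ v → Incident v e × Incident v f

-- two chords of a convex polygon cross (meet in a point interior to both)
-- iff their endpoints strictly interleave in the cyclic order
Cross : ∀ {n} → Edge n → Edge n → Set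
Cross e f = (lo e < lo f × lo f < hi e × hi e < hi f)
          ⊎ (lo f < lo e × lo e < hi f × hi f < hi e)

DisjointEdges : ∀ {n} → Edge n → Edge n → Set
DisjointEdges e f = ¬ ShareVertex e f × ¬ Cross e f

Adjacent : ∀ {n} → Fin n → Fin n → Set
Adjacent {n} a a' = (suc (toℕ a) ≡ toℕ a') ⊎ (suc (toℕ a') ≡ toℕ a)
                  ⊎ (toℕ a ≡ 0 × suc (toℕ a') ≡ n) ⊎ (toℕ a' ≡ 0 × suc (toℕ a) ≡ n)

-- Sets of edges are represented by duplicate-free lists; cardinality = length.
EdgeSet : ℕ → Set
EdgeSet n = List (Edge n)

Meets : ∀ {n} → EdgeSet n → EdgeSet n → Set
Meets A B = ∃ λ e → e ∈ A × e ∈ B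

IsSPM : (m : ℕ) → EdgeSet (2 * m) → Set
IsSPM m M = Unique M × length M ≡ m × AllPairs DisjointEdges M

IsPerfectMatching : (m : ℕ) → EdgeSet (2 * m) → Set
IsPerfectMatching m M =
  Unique M × length M ≡ m ×
  (∀ v → Σ (Edge (2 * m)) λ e → e ∈ M × Incident v e ×
           (∀ f → f ∈ M → Incident v f → f ≡ e))

IsMinHitting : ∀ {n} → (EdgeSet n → Set) → EdgeSet n → Set
IsMinHitting {n} F B =
  Unique B × (∀ S → F S → Meets B S) ×
  (∀ (B' : EdgeSet n) → Unique B' → (∀ S → F S → Meets B' S) → length B ≤ℕ length B')

IsBlocker : (m : ℕ) → EdgeSet (2 * m) → Set
IsBlocker m = IsMinHitting (IsSPM m)

IsCoBlocker : (m : ℕ) → EdgeSet (2 * m) → Set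
IsCoBlocker m = IsMinHitting (IsBlocker m)

NoAdjacentCrossing : ∀ {n} → EdgeSet n → Set
NoAdjacentCrossing C =
  ∀ e f → e ∈ C → f ∈ C → ∀ a b a' c →
    Joins e a b → Joins f a' c → Adjacent a a' → ¬ Cross e f

{-# OPTIONS --safe #-}

-- Cutting the circle into nested families of chords produces enough simple perfect matchings to
-- determine the blockers: the m parallel classes of odd direction are disjoint, so a blocker has
-- exactly one edge in each, at depth t κ below the boundary edge [κ , κ+1] for every κ. The simple
-- perfect matchings made of a nested family, one boundary edge and another nested family give
--   t κ ≥ p ≥ t (κ+1)  implies  t (κ+p+1) = 0,
-- which forces the zeros of t to be consecutive (the spine of a caterpillar), t to increase strictly
-- after them, and hence to decrease strictly at the antipode. A matching C as in (i), (ii) sends v to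
-- v + 2τ(v) + 1, where τ(v+1) < τ(v) unless τ(v) = 0. Followed along the spine, τ passes from above
-- to below the profile t, so it hits an edge of the blocker.
-- Conversely, the stars and double stars of odd edges are blockers; disjoint stars give |C| = m and
-- make C a perfect matching of odd edges, and double stars exclude the crossings of (ii).
module Submission where

open import Defs
open import Data.Nat
open import Data.Nat.Properties
open import Data.Nat.DivMod
open import Data.Nat.Divisibility using (_∣_; divides)
open import Data.Nat.Induction using (<-wellFounded; Acc; acc)
open import Data.Nat.Tactic.RingSolver using (solve-∀)
open import Data.Fin as Fin using (Fin; toℕ; fromℕ<)
import Data.Fin.Properties as Fin
open import Data.List using (List; []; _∷_; _++_; length; lookup; tabulate)
open import Data.List.Properties using (length-++; length-tabulate)
open import Data.List.Membership.Propositional using (_∈_; find; lose)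
open import Data.List.Membership.Propositional.Properties using (∈-lookup; ∈-tabulate⁺; ∈-tabulate⁻)
import Data.List.Membership.DecPropositional as DecMembership
open import Data.List.Relation.Unary.All as All using (All; []; _∷_)
import Data.List.Relation.Unary.All.Properties as All
open import Data.List.Relation.Unary.Any as Any using (here; there)
open import Data.List.Relation.Unary.Any.Properties using (lookup-index)
open import Data.List.Relation.Unary.AllPairs as AllPairs using (AllPairs; []; _∷_)
import Data.List.Relation.Unary.AllPairs.Properties as AllPairs
open import Data.List.Relation.Unary.Unique.Propositional using (Unique)
import Data.List.Relation.Unary.Unique.Propositional.Properties as Unique
open import Data.Product using (_×_; _,_; proj₁; proj₂; ∃; ∃₂)
open import Data.Sum using (_⊎_; inj₁; inj₂; swap)
open import Data.Empty using (⊥; ⊥-elim)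
open import Function using (_∘_)
open import Function.Bundles using (_⇔_; mk⇔)
open import Relation.Binary.Definitions using (tri<; tri≈; tri>)
open import Relation.Binary.PropositionalEquality
open import Relation.Nullary
open import Relation.Nullary.Decidable using (decidable-stable)
open import Relation.Unary using (Decidable)

-- Inequalities and linear search

-- The hypothesis says y − x = (b − a) + k, rearranged so that no subtraction occurs.
lin : ∀ {a b x y} k → a ≤ b → x + b + k ≡ y + a → x ≤ y
lin {a} {b} {x} {y} k a≤b eq = +-cancelʳ-≤ b x y (begin
  x + b     ≤⟨ m≤m+n (x + b) k ⟩
  x + b + k ≡⟨ eq ⟩
  y + a     ≤⟨ +-monoʳ-≤ y a≤b ⟩
  y + b     ∎)
  where open ≤-Reasoning

infixr 6 _⊞_
_⊞_ : ∀ {a b c d} → a ≤ b → c ≤ d → a + c ≤ b + d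
_⊞_ = +-mono-≤

-- Applied first to the nonvanishing and then to the vanishing of `t`, this cuts out a maximal run
-- of zeros.
leaves : {P : ℕ → Set} → Decidable P → ∀ k x → P x → ¬ P (x + k) →
         ∃ λ i → i < k × (∀ j → j ≤ i → P (x + j)) × ¬ P (suc (x + i))
leaves {P} P? zero x px ¬p = ⊥-elim (¬p (subst P (sym (+-identityʳ x)) px))
leaves {P} P? (suc k) x px ¬p with P? (suc x)
... | no ¬q = 0 , z<s , (λ { zero _ → subst P (sym (+-identityʳ x)) px }) ,
              subst (λ y → ¬ P (suc y)) (sym (+-identityʳ x)) ¬q
... | yes q with i , i<k , all , ¬r ← leaves P? k (suc x) q (subst (λ y → ¬ P y) (+-suc x k) ¬p) =
  suc i , s<s i<k , all′ , subst (λ y → ¬ P (suc y)) (sym (+-suc x i)) ¬r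
  where
  all′ : ∀ j → j ≤ suc i → P (x + j)
  all′ zero    _         = subst P (sym (+-identityʳ x)) px
  all′ (suc j) (s≤s j≤i) = subst P (sym (+-suc x j)) (all j j≤i)

-- Depth profiles and walks

module Profile (m : ℕ) (t : ℕ → ℕ)
  -- `t κ` stands for the depth of the blocker's edge below [κ , κ+1], and `antipode` views that
  -- edge from the opposite side. Indices run over all naturals, so that windows need no reduction
  -- modulo 2m.
  (antipode : ∀ κ → suc (t (κ + m) + t κ) ≡ m)
  (turn : ∀ κ p → p < m → p ≤ t κ → t (suc κ) ≤ p → t (suc (κ + p)) ≡ 0)
  where

  t<m : ∀ κ → t κ < m
  t<m κ = ≤-trans (s≤s (m≤n+m (t κ) (t (κ + m)))) (≤-reflexive (antipode κ))

  periodic : ∀ κ → t (κ + m + m) ≡ t κ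
  periodic κ = +-cancelʳ-≡ (t (κ + m)) _ _ (suc-injective (begin
    suc (t (κ + m + m) + t (κ + m)) ≡⟨ antipode (κ + m) ⟩
    m                               ≡⟨ antipode κ ⟨
    suc (t (κ + m) + t κ)           ≡⟨ cong suc (+-comm (t (κ + m)) (t κ)) ⟩
    suc (t κ + t (κ + m))           ∎))
    where open ≡-Reasoning

  antipode-≤ : ∀ κ {p q} → suc (p + q) ≡ m → t κ ≤ p → q ≤ t (κ + m)
  antipode-≤ κ {p} {q} pq tκ≤p = lin 0 (≤-reflexive (trans pq (sym (antipode κ))) ⊞ tκ≤p)
    (lem q p (t κ) (t (κ + m)))
    where
    lem : ∀ q p x y → q + (suc (y + x) + p) + 0 ≡ y + (suc (p + q) + x)
    lem = solve-∀

  antipode-≥ : ∀ κ {p q} → suc (p + q) ≡ m → p ≤ t κ → t (κ + m) ≤ q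
  antipode-≥ κ {p} {q} pq p≤tκ = lin 0 (≤-reflexive (trans (antipode κ) (sym pq)) ⊞ p≤tκ)
    (lem q p (t κ) (t (κ + m)))
    where
    lem : ∀ q p x y → y + (suc (p + q) + x) + 0 ≡ q + (suc (y + x) + p)
    lem = solve-∀

  antipode-zero : ∀ κ → t κ ≡ 0 → suc (t (κ + m)) ≡ m
  antipode-zero κ z = trans (cong suc (sym (trans (cong (t (κ + m) +_) z) (+-identityʳ _)))) (antipode κ)

  -- The mirror image of `turn`: at the antipode a depth x becomes m - 1 - x, which reverses both
  -- inequalities. The zero is found at b + 2m and moved back by periodicity.
  turn′ : ∀ b p → p < m → t (b + p) ≤ p → p ≤ t (suc (b + p)) → t b ≡ 0
  turn′ b p p<m le ge = trans (sym (periodic b)) (trans (cong t pos) (turn (b + p + m) q q<m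
      (antipode-≤ (b + p) pq le) (antipode-≥ (suc (b + p)) pq ge)))
    where
    q = m ∸ suc p
    pq : suc (p + q) ≡ m
    pq = m+[n∸m]≡n p<m
    q<m : q < m
    q<m = ≤-trans (s≤s (m≤n+m q p)) (≤-reflexive pq)
    lem : ∀ b m p q → b + m + suc (p + q) ≡ suc (b + p + m + q)
    lem = solve-∀
    pos : b + m + m ≡ suc (b + p + m + q)
    pos = trans (cong (b + m +_) (sym pq)) (lem b m p q)

  -- Without a zero the turning condition would make t strictly increasing.
  zero-exists : ∃ λ z → t z ≡ 0
  zero-exists with grow m
    where
    grow : ∀ k → (∃ λ z → t z ≡ 0) ⊎ k ≤ t k
    grow zero = inj₂ z≤n
    grow (suc k) with grow k
    ... | inj₁ z = inj₁ z
    ... | inj₂ k≤ with t (suc k) ≤? t k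
    ...   | yes le = inj₁ (_ , turn k (t k) (t<m k) ≤-refl le)
    ...   | no ¬le = inj₂ (≤-trans (s≤s k≤) (≰⇒> ¬le))
  ... | inj₁ z  = z
  ... | inj₂ le = ⊥-elim (<⇒≱ (t<m m) le)

  -- [b + 1 , b + 1 + L] is a maximal run of zeros.
  module Run (b L : ℕ) (1<m : 1 < m) (m≤b : m ≤ b) (L<m : L < m)
    (before : t b ≢ 0) (run : ∀ j → j ≤ L → t (suc b + j) ≡ 0)
    (after : t (suc (suc b + L)) ≢ 0) where

    a k : ℕ
    a = suc b
    k = a + L

    t[k]≡0 : t k ≡ 0
    t[k]≡0 = run L ≤-refl

    t[a]≡0 : t a ≡ 0
    t[a]≡0 = trans (cong t (sym (+-identityʳ a))) (run 0 z≤n)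

    -- If t κ ≥ p, then `turn` puts a zero at k + 1, against `after`, unless t (κ+1) > p; induction
    -- on the distance to k excludes that too.
    below-k : ∀ p κ → κ + p ≡ k → 0 < p → p < m → t κ < p
    below-k (suc p) κ eq _ p<m with t κ <? suc p
    ... | yes lt = lt
    ... | no ¬lt with t (suc κ) ≤? suc p
    ...   | yes le = ⊥-elim (after (trans (cong t (cong suc (sym eq))) (turn κ (suc p) p<m (≮⇒≥ ¬lt) le)))
    below-k (suc zero) κ eq _ p<m | no ¬lt | no ¬le = ⊥-elim (¬le (≤-trans (≤-reflexive
      (trans (cong t (trans (sym (+-comm κ 1)) eq)) t[k]≡0)) z≤n))
    below-k (suc (suc p)) κ eq _ p<m | no ¬lt | no ¬le = ⊥-elim (¬le (≤-trans (<⇒≤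
      (below-k (suc p) (suc κ) (trans (sym (+-suc κ (suc p))) eq) z<s (≤-trans (n≤1+n _) p<m))) (n≤1+n _)))

    -- The antipodal form of `below-k`, with p + q = m.
    above-k : ∀ q → 0 < q → q < m → q ≤ t (k + q)
    above-k q@(suc q-1) 0<q q<m = subst (λ x → q ≤ t x) pos
        (antipode-≤ κ {p-1} {q} pq (≤-pred (below-k p κ κ+p z<s p<m)))
      where
      p-1 = m ∸ suc q
      p = suc p-1
      pq : suc (p-1 + suc q-1) ≡ m
      pq = trans (lem (suc q-1) p-1) (m+[n∸m]≡n q<m)
        where
        lem : ∀ x y → suc (y + x) ≡ suc (x + y)
        lem = solve-∀
      p<m : p < m
      p<m = lin q-1 (≤-reflexive pq) (lem p-1 q-1 m)
        where
        lem : ∀ x y m → suc (suc x) + m + y ≡ m + suc (x + suc y)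
        lem = solve-∀
      -- A genuine difference, because p < m ≤ b.
      κ = k ∸ p
      κ+p : κ + p ≡ k
      κ+p = m∸n+n≡m (≤-trans (<⇒≤ p<m) (≤-trans m≤b (≤-trans (n≤1+n b) (m≤m+n a L))))
      pos : κ + m ≡ k + q
      pos = trans (cong (κ +_) (sym pq)) (trans (lem κ p-1 q) (cong (_+ q) κ+p))
        where
        lem : ∀ x y z → x + suc (y + z) ≡ x + suc y + z
        lem = solve-∀

    -- Symmetric to `below-k` at the other end of the run: `turn′` would give a zero at b.
    above-a : ∀ p → 0 < p → p < m → t (a + p) < p
    above-a p@(suc _) _ p<m with t (a + p) <? p
    ... | yes lt = lt
    ... | no ¬lt with t (b + p) ≤? p
    ...   | yes le = ⊥-elim (before (turn′ b p p<m le (≮⇒≥ ¬lt)))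
    above-a (suc zero) _ p<m | no ¬lt | no ¬le = ⊥-elim (¬le (≤-trans (≤-reflexive
      (trans (cong t (+-comm b 1)) t[a]≡0)) z≤n))
    above-a (suc (suc p)) _ p<m | no ¬lt | no ¬le = ⊥-elim (¬le (≤-trans (<⇒≤
      (subst (λ x → t x < suc p) (sym (+-suc b (suc p))) (above-a (suc p) z<s (≤-trans (n≤1+n _) p<m)))) (n≤1+n _)))

    antipodal-nonzero : ∀ p → p < m → t (a + p + m) ≢ 0
    antipodal-nonzero zero _ z = <⇒≢ 1<m
      (trans (cong suc (sym (trans (cong (λ x → t (x + m)) (sym (+-identityʳ a))) z))) (antipode-zero a t[a]≡0))
    antipodal-nonzero p@(suc _) p<m z = <⇒≢ (≤-trans (s≤s (above-a p z<s p<m)) p<m)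
      (trans (cong (λ x → suc (x + t (a + p))) (sym z)) (antipode (a + p)))

    -- Zeros thus form one run per period. At distance less than m beyond k `above-k` applies; after
    -- that κ is the antipode of some a + p with p < m, whose depth is below m - 1.
    nonzero : ∀ κ → k < κ → κ < a + m + m → t κ ≢ 0
    nonzero κ k<κ κ<a+2m z with κ ∸ k | m+[n∸m]≡n (<⇒≤ k<κ)
    ... | q | refl with q <? m
    ...   | yes q<m = <⇒≱ 0<q (≤-trans (above-k q 0<q q<m) (≤-reflexive z))
      where
      0<q : 0 < q
      0<q = lin 0 k<κ (lem k q)
        where
        lem : ∀ k q → 1 + (k + q) + 0 ≡ q + suc k
        lem = solve-∀
    ...   | no q≮m = antipodal-nonzero (L + (q ∸ m)) p<m (trans (cong t (sym pos)) z)
      where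
      q≡ : m + (q ∸ m) ≡ q
      q≡ = m+[n∸m]≡n (≮⇒≥ q≮m)
      lem : ∀ a L q′ m → a + L + (m + q′) ≡ a + (L + q′) + m
      lem = solve-∀
      pos : k + q ≡ a + (L + (q ∸ m)) + m
      pos = trans (cong (k +_) (sym q≡)) (lem a L (q ∸ m) m)
      p<m : L + (q ∸ m) < m
      p<m = lin 0 (≤-trans (≤-reflexive (cong suc (sym pos))) κ<a+2m) (lem′ (L + (q ∸ m)) a m)
        where
        lem′ : ∀ x a m → suc x + (a + m + m) + 0 ≡ m + suc (a + x + m)
        lem′ = solve-∀

    -- Otherwise `turn` with p = t κ places a zero at κ + t κ + 1, which lies after k and before a +
    -- 2m.
    increasing : ∀ κ → k ≤ κ → suc κ < a + m → t κ < t (suc κ)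
    increasing κ k≤κ sκ< with t κ <? t (suc κ)
    ... | yes lt = lt
    ... | no ¬lt = ⊥-elim (nonzero (suc (κ + t κ)) (s≤s (≤-trans k≤κ (m≤m+n κ (t κ))))
          (lin 1 (sκ< ⊞ t<m κ) (lem κ (t κ) a m))
          (turn κ (t κ) (t<m κ) ≤-refl (≮⇒≥ ¬lt)))
      where
      lem : ∀ κ x a m → suc (suc (κ + x)) + (a + m + m) + 1 ≡ a + m + m + (suc (suc κ) + suc x)
      lem = solve-∀

    increasing-by : ∀ d κ → k ≤ κ → κ + d < a + m → t κ + d ≤ t (κ + d)
    increasing-by zero κ _ _ = ≤-reflexive (trans (+-identityʳ _) (cong t (sym (+-identityʳ κ))))
    increasing-by (suc d) κ k≤κ lt rewrite +-suc κ d | +-suc (t κ) d =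
      ≤-trans (s≤s (increasing-by d κ k≤κ (≤-trans (n≤1+n _) lt)))
              (increasing (κ + d) (≤-trans k≤κ (m≤m+n κ d)) lt)

    -- The edge from v to v + 2τ(v) + 1 is parallel to [v + τ(v) , v + τ(v) + 1] and has depth τ(v)
    -- below it, so `avoid` says that the walk uses no edge of the blocker.
    module Walk (τ : ℕ → ℕ) (τ<m : ∀ v → τ v < m)
      (step : ∀ v → τ v ≡ 0 ⊎ τ (suc v) < τ v)
      (avoid : ∀ v → t (v + τ v) ≢ τ v) where

      -- Invariant along v = a + 1, …, k + 1; at v = k + 1 it contradicts above-k.
      Above : ℕ → Set
      Above v = v + τ v < a + m × t (v + τ v) < τ v

      -- `above-a` gives t ≤ τ and `avoid` makes it strict. The extreme value τ = m - 1 lands on the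
      -- antipode of a, where t is m - 1 as well.
      start : Above (suc a)
      start with suc (τ (suc a)) <? m
      ... | yes lt = lin 0 lt (lem a (τ (suc a)) m) ,
                     ≤∧≢⇒< (≤-pred (subst (λ x → t x < suc (τ (suc a))) (+-suc a _) (above-a _ z<s lt)))
                           (avoid (suc a))
        where
        lem : ∀ a x m → suc (suc a + x) + m + 0 ≡ a + m + suc (suc x)
        lem = solve-∀
      ... | no ¬lt = ⊥-elim (avoid (suc a) (suc-injective (trans (cong (λ x → suc (t x)) pos)
                       (trans (antipode-zero a t[a]≡0) (sym top)))))
        where
        top : suc (τ (suc a)) ≡ m
        top = ≤-antisym (τ<m (suc a)) (≮⇒≥ ¬lt)
        pos : suc a + τ (suc a) ≡ a + m
        pos = trans (sym (+-suc a _)) (cong (a +_) top)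

      -- The position v + τ(v) never moves forward. On the run of zeros t ≤ τ is trivial; beyond k,
      -- going back by d lowers t by at least d and τ by exactly d + 1, so t < τ leaves t ≤ τ, and
      -- `avoid` makes it strict.
      next : ∀ v → a ≤ v → v ≤ k → Above v → Above (suc v)
      next v a≤v v≤k (lt , below) with step v
      ... | inj₁ τ≡0 = ⊥-elim (n≮0 (subst (t (v + τ v) <_) τ≡0 below))
      ... | inj₂ down = κ′< , ≤∧≢⇒< below′ (avoid (suc v))
        where
        κ κ′ d : ℕ
        κ  = v + τ v
        κ′ = suc v + τ (suc v)
        d  = κ ∸ κ′
        κ′≤κ : κ′ ≤ κ
        κ′≤κ = ≤-trans (≤-reflexive (sym (+-suc v _))) (+-monoʳ-≤ v down)
        κ′+d : κ′ + d ≡ κ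
        κ′+d = m+[n∸m]≡n κ′≤κ
        κ′< : κ′ < a + m
        κ′< = ≤-trans (s≤s κ′≤κ) lt
        below′ : t κ′ ≤ τ (suc v)
        below′ with κ′ ≤? k
        ... | yes κ′≤k = ≤-trans (≤-reflexive (trans (cong t (sym (m+[n∸m]≡n a≤κ′)))
                           (run (κ′ ∸ a) (≤-trans (∸-monoˡ-≤ a κ′≤k) (≤-reflexive (m+n∸m≡n a L)))))) z≤n
          where
          a≤κ′ : a ≤ κ′
          a≤κ′ = ≤-trans a≤v (≤-trans (n≤1+n v) (m≤m+n (suc v) _))
        ... | no κ′≰k = lin 0 (increasing-by d κ′ (<⇒≤ (≰⇒> κ′≰k)) (≤-trans (≤-reflexive (cong suc κ′+d)) lt)
                             ⊞ subst (λ x → t x < τ v) (sym κ′+d) below ⊞ ≤-reflexive (sym κ′+d))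
                            (lem (t κ′) (t (κ′ + d)) (τ v) (τ (suc v)) v d)
          where
          lem : ∀ x y z w v d → x + (y + (z + (suc v + w + d))) + 0 ≡ w + (x + d + (suc y + (v + z)))
          lem = solve-∀

      all-above : ∀ i → i ≤ L → Above (suc a + i)
      all-above zero    _   = subst Above (sym (+-identityʳ (suc a))) start
      all-above (suc i) i<L = subst Above (sym (+-suc (suc a) i))
        (next (suc a + i) (≤-trans (n≤1+n a) (m≤m+n (suc a) i))
              (≤-trans (≤-reflexive (sym (+-suc a i))) (+-monoʳ-≤ a i<L)) (all-above i (<⇒≤ i<L)))

      absurd : ⊥
      absurd with lt , below ← all-above L ≤-refl =
        <⇒≱ below (≤-trans (n≤1+n _) (subst (λ x → suc (τ (suc k)) ≤ t x) (+-suc k _) (above-k _ z<s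
          (≤-trans (lin 0 (lt ⊞ m≤m+n a L) (lem a L (τ (suc k)) m)) ≤-refl))))
        where
        lem : ∀ a L x m → suc (suc x) + (a + m + (a + L)) + 0 ≡ m + (suc (suc (a + L) + x) + a)
        lem = solve-∀

  walk-meets-profile : (τ : ℕ → ℕ) → (∀ v → τ v < m) → (∀ v → τ v ≡ 0 ⊎ τ (suc v) < τ v) →
                       ¬ (∀ v → t (v + τ v) ≢ τ v)
  walk-meets-profile τ τ<m step avoid with 1 <? m
  ... | no 1≮m = avoid 0 (trans (n<1⇒n≡0 (≤-trans (t<m _) (≮⇒≥ 1≮m)))
                               (sym (n<1⇒n≡0 (≤-trans (τ<m 0) (≮⇒≥ 1≮m)))))
  ... | yes 1<m
    with z , tz ← zero-exists
    -- As m > 1, the antipode z + m of a zero is not a zero, while z + 2m is one again, so a run of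
    -- zeros begins in between. Starting at z + m also yields m ≤ b.
    with i , _ , all , ¬after ← leaves (λ x → ¬? (t x ≟ 0)) m (z + m)
           (λ z′ → <⇒≢ 1<m (trans (cong suc (sym z′)) (antipode-zero z tz)))
           (λ nz → nz (trans (periodic z) tz))
    with b ← z + m + i in b≡
    with ta ← decidable-stable (t (suc b) ≟ 0) ¬after
    with L , L<m , run , after ← leaves (λ x → t x ≟ 0) m (suc b) ta
           (λ z′ → <⇒≢ 1<m (trans (cong suc (sym z′)) (antipode-zero (suc b) ta)))
    = Run.Walk.absurd b L 1<m (≤-trans (≤-trans (m≤n+m m z) (m≤m+n (z + m) i)) (≤-reflexive b≡)) L<m
        (λ tb → all i ≤-refl (trans (cong t b≡) tb)) run after τ τ<m step avoid

-- Chords and the cyclic order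

edge-≡ : ∀ {n} {e f : Edge n} → lo e ≡ lo f → hi e ≡ hi f → e ≡ f
edge-≡ {e = edge l h p} {edge .l .h q} refl refl = cong (edge l h) (≤-irrelevant p q)

joins-sym : ∀ {n} (e : Edge n) {x y} → Joins e x y → Joins e y x
joins-sym _ = swap

joins-unique : ∀ {n} (e f : Edge n) {x y} → Joins e x y → Joins f x y → e ≡ f
joins-unique e f (inj₁ (refl , refl)) (inj₁ (p , q)) = edge-≡ (sym p) (sym q)
joins-unique e f (inj₂ (refl , refl)) (inj₂ (p , q)) = edge-≡ (sym p) (sym q)
joins-unique e f (inj₁ (refl , refl)) (inj₂ (p , q)) =
  ⊥-elim (<-asym (lo<hi e) (subst₂ (λ x y → toℕ x < toℕ y) p q (lo<hi f)))
joins-unique e f (inj₂ (refl , refl)) (inj₁ (p , q)) =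
  ⊥-elim (<-asym (lo<hi e) (subst₂ (λ x y → toℕ x < toℕ y) p q (lo<hi f)))

joins-other : ∀ {n} (e : Edge n) {x y z} → Joins e x y → Joins e x z → y ≡ z
joins-other e (inj₁ (refl , refl)) (inj₁ (_ , q)) = q
joins-other e (inj₂ (refl , refl)) (inj₂ (p , _)) = p
joins-other e (inj₁ (refl , _)) (inj₂ (_ , q)) = ⊥-elim (<⇒≢ (lo<hi e) (cong toℕ (sym q)))
joins-other e (inj₂ (_ , refl)) (inj₁ (p , _)) = ⊥-elim (<⇒≢ (lo<hi e) (cong toℕ p))

joins-lohi : ∀ {n} (e : Edge n) {x y} → Joins e x y → toℕ x < toℕ y → lo e ≡ x × hi e ≡ y
joins-lohi e (inj₁ p) _ = p
joins-lohi e (inj₂ (refl , refl)) x<y = ⊥-elim (<-asym x<y (lo<hi e))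

joins⇒incident : ∀ {n} (e : Edge n) {x y} → Joins e x y → Incident x e
joins⇒incident e (inj₁ (p , _)) = inj₁ p
joins⇒incident e (inj₂ (_ , p)) = inj₂ p

incident⇒joins : ∀ {n} (e : Edge n) {x} → Incident x e → ∃ λ y → Joins e x y
incident⇒joins e (inj₁ p) = _ , inj₁ (p , refl)
incident⇒joins e (inj₂ p) = _ , inj₂ (refl , p)

incident-either : ∀ {n} (e : Edge n) {x y z} → Joins e x y → Incident z e → z ≡ x ⊎ z ≡ y
incident-either e (inj₁ (p , q)) (inj₁ r) = inj₁ (trans (sym r) p)
incident-either e (inj₁ (p , q)) (inj₂ r) = inj₂ (trans (sym r) q)
incident-either e (inj₂ (p , q)) (inj₁ r) = inj₂ (trans (sym r) p)
incident-either e (inj₂ (p , q)) (inj₂ r) = inj₁ (trans (sym r) q)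

chord : ∀ {n} (x y : Fin n) → x ≢ y → ∃ λ e → Joins e x y
chord x y x≢y with Fin.<-cmp x y
... | tri< lt _ _ = edge x y lt , inj₁ (refl , refl)
... | tri≈ _ eq _ = ⊥-elim (x≢y eq)
... | tri> _ _ gt = edge y x gt , inj₂ (refl , refl)

cross-sym : ∀ {n} (e f : Edge n) → Cross e f → Cross f e
cross-sym _ _ = swap

share-sym : ∀ {n} (e f : Edge n) → ShareVertex e f → ShareVertex f e
share-sym _ _ (v , p , q) = v , q , p

cross⇒¬share : ∀ {n} (e f : Edge n) → Cross e f → ¬ ShareVertex e f
cross⇒¬share e f (inj₁ (p , q , r)) (v , inj₁ refl , inj₁ s) = <⇒≢ p (cong toℕ (sym s))
cross⇒¬share e f (inj₁ (p , q , r)) (v , inj₁ refl , inj₂ s) = <⇒≢ (<-trans p (lo<hi f)) (cong toℕ (sym s))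
cross⇒¬share e f (inj₁ (p , q , r)) (v , inj₂ refl , inj₁ s) = <⇒≢ q (cong toℕ s)
cross⇒¬share e f (inj₁ (p , q , r)) (v , inj₂ refl , inj₂ s) = <⇒≢ r (cong toℕ (sym s))
cross⇒¬share e f (inj₂ (p , q , r)) (v , inj₁ refl , inj₁ s) = <⇒≢ p (cong toℕ s)
cross⇒¬share e f (inj₂ (p , q , r)) (v , inj₁ refl , inj₂ s) = <⇒≢ q (cong toℕ (sym s))
cross⇒¬share e f (inj₂ (p , q , r)) (v , inj₂ refl , inj₁ s) = <⇒≢ (<-trans p (lo<hi e)) (cong toℕ s)
cross⇒¬share e f (inj₂ (p , q , r)) (v , inj₂ refl , inj₂ s) = <⇒≢ r (cong toℕ s)

module _ {n} (e f : Edge n) {p q r s : Fin n} where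

  cross-interleaved : toℕ p < toℕ q → toℕ q < toℕ r → toℕ r < toℕ s →
    Joins e p r → Joins f q s → Cross e f
  cross-interleaved x y z je jf
    with refl , refl ← joins-lohi e je (<-trans x y)
    with refl , refl ← joins-lohi f jf (<-trans y z) = inj₁ (x , y , z)

  ¬cross-separated : toℕ p < toℕ q → toℕ q < toℕ r → toℕ r < toℕ s →
    Joins e p q → Joins f r s → ¬ Cross e f
  ¬cross-separated x y z je jf
    with refl , refl ← joins-lohi e je x
    with refl , refl ← joins-lohi f jf z = λ where
      (inj₁ (_ , k , _)) → <-asym y k
      (inj₂ (k , _ , _)) → <-asym (<-trans x y) k

  ¬cross-nested : toℕ p < toℕ q → toℕ q < toℕ r → toℕ r < toℕ s →
    Joins e p s → Joins f q r → ¬ Cross e f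
  ¬cross-nested x y z je jf
    with refl , refl ← joins-lohi e je (<-trans x (<-trans y z))
    with refl , refl ← joins-lohi f jf y = λ where
      (inj₁ (_ , _ , k)) → <-asym z k
      (inj₂ (k , _ , _)) → <-asym x k

module Cyclic (n : ℕ) .{{_ : NonZero n}} where

  pt : ℕ → Fin n
  pt x = fromℕ< (m%n<n x n)

  toℕ-pt : ∀ x → toℕ (pt x) ≡ x % n
  toℕ-pt x = Fin.toℕ-fromℕ< (m%n<n x n)

  pt-cong : ∀ {x y} → x % n ≡ y % n → pt x ≡ pt y
  pt-cong eq = Fin.fromℕ<-cong _ _ eq _ _

  pt-toℕ : ∀ v → pt (toℕ v) ≡ v
  pt-toℕ v = Fin.toℕ-injective (trans (toℕ-pt (toℕ v)) (m<n⇒m%n≡m (Fin.toℕ<n v)))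

  pt-+n : ∀ x → pt (x + n) ≡ pt x
  pt-+n x = pt-cong ([m+n]%n≡m%n x n)

  %-window : ∀ w {x y} → x < n → y < n → (w + x) % n ≡ (w + y) % n → x ≡ y
  %-window w {x} {y} x<n y<n eq = begin
    x                  ≡⟨ m<n⇒m%n≡m x<n ⟨
    x % n              ≡⟨ shift x ⟨
    (w′ + (w + x)) % n ≡⟨ %-distribˡ-+ w′ (w + x) n ⟩
    (w′ % n + (w + x) % n) % n ≡⟨ cong (λ r → (w′ % n + r) % n) eq ⟩
    (w′ % n + (w + y) % n) % n ≡⟨ %-distribˡ-+ w′ (w + y) n ⟨
    (w′ + (w + y)) % n ≡⟨ shift y ⟩
    y % n              ≡⟨ m<n⇒m%n≡m y<n ⟩
    y                  ∎
    where
    open ≡-Reasoning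
    -- Serves as -w modulo n.
    w′ = w * n ∸ w
    full : w′ + w ≡ w * n
    full = m∸n+n≡m (m≤m*n w n)
    shift : ∀ z → (w′ + (w + z)) % n ≡ z % n
    shift z = trans (cong (_% n) (trans (sym (+-assoc w′ w z)) (trans (cong (_+ z) full) (+-comm (w * n) z))))
                    ([m+kn]%n≡m%n z w n)

  pt-window : ∀ w {x y} → x < n → y < n → pt (w + x) ≡ pt (w + y) → x ≡ y
  pt-window w {x} {y} x<n y<n eq =
    %-window w x<n y<n (trans (sym (toℕ-pt (w + x))) (trans (cong toℕ eq) (toℕ-pt (w + y))))

  pt-window′ : ∀ {w x y} → w ≤ x → x < w + n → w ≤ y → y < w + n → pt x ≡ pt y → x ≡ y
  pt-window′ {w} {x} {y} w≤x x< w≤y y< eq = trans (sym x≡) (trans (cong (w +_) (pt-window w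
      (+-cancelˡ-< w _ _ (subst (_< w + n) (sym x≡) x<)) (+-cancelˡ-< w _ _ (subst (_< w + n) (sym y≡) y<))
      (trans (cong pt x≡) (trans eq (cong pt (sym y≡)))))) y≡)
    where
    x≡ : w + (x ∸ w) ≡ x
    x≡ = m+[n∸m]≡n w≤x
    y≡ : w + (y ∸ w) ≡ y
    y≡ = m+[n∸m]≡n w≤y

  offset : ∀ w v → ∃ λ x → x < n × v ≡ pt (w + x)
  offset w v = (w′ + toℕ v) % n , m%n<n _ n , sym (begin
      pt (w + (w′ + toℕ v) % n) ≡⟨ pt-cong mod-eq ⟩
      pt (toℕ v) ≡⟨ pt-toℕ v ⟩
      v ∎)
    where
    open ≡-Reasoning
    w′ = w * n ∸ w
    full : w + w′ ≡ w * n
    full = m+[n∸m]≡n (m≤m*n w n)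
    mod-eq : (w + (w′ + toℕ v) % n) % n ≡ toℕ v % n
    mod-eq = begin
      (w + (w′ + toℕ v) % n) % n           ≡⟨ %-distribˡ-+ w _ n ⟩
      (w % n + (w′ + toℕ v) % n % n) % n   ≡⟨ cong (λ r → (w % n + r) % n) (m%n%n≡m%n (w′ + toℕ v) n) ⟩
      (w % n + (w′ + toℕ v) % n) % n       ≡⟨ %-distribˡ-+ w (w′ + toℕ v) n ⟨
      (w + (w′ + toℕ v)) % n ≡⟨ cong (_% n) (trans (sym (+-assoc w w′ _)) (trans (cong (_+ toℕ v) full) (+-comm (w * n) _))) ⟩
      (toℕ v + w * n) % n    ≡⟨ [m+kn]%n≡m%n (toℕ v) w n ⟩
      toℕ v % n              ∎

  _≺_ : ℕ → ℕ → Set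
  x ≺ y = toℕ (pt x) < toℕ (pt y)

  Increasing : ℕ → ℕ → ℕ → ℕ → Set
  Increasing a b c d = a ≺ b × b ≺ c × c ≺ d

  ≺-small : ∀ {x y} → x < y → y < n → x ≺ y
  ≺-small {x} {y} x<y y<n = subst₂ _<_ (sym (trans (toℕ-pt x) (m<n⇒m%n≡m (<-trans x<y y<n))))
                                       (sym (trans (toℕ-pt y) (m<n⇒m%n≡m y<n))) x<y

  -- For d < n the residues are the numbers themselves. Otherwise d - n has the same residue as d
  -- and precedes a, which is one rotation; the recursion is on the largest of the four.
  cyclic-order : ∀ {a b c d} → a < b → b < c → c < d → d < a + n →
    Increasing a b c d ⊎ Increasing b c d a ⊎ Increasing c d a b ⊎ Increasing d a b c
  cyclic-order {d = d} = go (<-wellFounded d)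
    where
    go : ∀ {a b c d} → Acc _<_ d → a < b → b < c → c < d → d < a + n →
      Increasing a b c d ⊎ Increasing b c d a ⊎ Increasing c d a b ⊎ Increasing d a b c
    go {a} {b} {c} {d} (acc rs) a<b b<c c<d d<a+n with d <? n
    ... | yes d<n = inj₁ (≺-small a<b (<-trans b<c (<-trans c<d d<n)) , ≺-small b<c (<-trans c<d d<n) , ≺-small c<d d<n)
    ... | no d≮n = rotate (go {d′} {a} {b} {c} (rs c<d) d′<a a<b b<c
          (≤-trans c<d (≤-reflexive (sym d′+n))))
      where
      d′ = d ∸ n
      d′+n : d′ + n ≡ d
      d′+n = m∸n+n≡m (≮⇒≥ d≮n)
      d′<a : d′ < a
      d′<a = +-cancelʳ-< n _ _ (subst (_< a + n) (sym d′+n) d<a+n)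
      d≡ : pt d′ ≡ pt d
      d≡ = trans (sym (pt-+n d′)) (cong pt d′+n)
      rotate : Increasing d′ a b c ⊎ Increasing a b c d′ ⊎ Increasing b c d′ a ⊎ Increasing c d′ a b →
               Increasing a b c d ⊎ Increasing b c d a ⊎ Increasing c d a b ⊎ Increasing d a b c
      rotate rewrite d≡ = λ where
        (inj₁ p)               → inj₂ (inj₂ (inj₂ p))
        (inj₂ (inj₁ p))        → inj₁ p
        (inj₂ (inj₂ (inj₁ p))) → inj₂ (inj₁ p)
        (inj₂ (inj₂ (inj₂ p))) → inj₂ (inj₂ (inj₁ p))

  module _ (e f : Edge n) {a b c d : ℕ} (a<b : a < b) (b<c : b < c) (c<d : c < d) (d<a+n : d < a + n) where

    interleaved⇒cross : Joins e (pt a) (pt c) → Joins f (pt b) (pt d) → Cross e f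
    interleaved⇒cross je jf with cyclic-order a<b b<c c<d d<a+n
    ... | inj₁ (x , y , z)               = cross-interleaved e f x y z je jf
    ... | inj₂ (inj₁ (x , y , z))        = swap (cross-interleaved f e x y z jf (swap je))
    ... | inj₂ (inj₂ (inj₁ (x , y , z))) = cross-interleaved e f x y z (swap je) (swap jf)
    ... | inj₂ (inj₂ (inj₂ (x , y , z))) = swap (cross-interleaved f e x y z (swap jf) je)

    separated⇒¬cross : Joins e (pt a) (pt b) → Joins f (pt c) (pt d) → ¬ Cross e f
    separated⇒¬cross je jf with cyclic-order a<b b<c c<d d<a+n
    ... | inj₁ (x , y , z)               = ¬cross-separated e f x y z je jf
    ... | inj₂ (inj₁ (x , y , z))        = ¬cross-nested e f x y z (swap je) jf
    ... | inj₂ (inj₂ (inj₁ (x , y , z))) = ¬cross-separated f e x y z jf je ∘ swap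
    ... | inj₂ (inj₂ (inj₂ (x , y , z))) = ¬cross-nested f e x y z (swap jf) je ∘ swap

    nested⇒¬cross : Joins e (pt a) (pt d) → Joins f (pt b) (pt c) → ¬ Cross e f
    nested⇒¬cross je jf with cyclic-order a<b b<c c<d d<a+n
    ... | inj₁ (x , y , z)               = ¬cross-nested e f x y z je jf
    ... | inj₂ (inj₁ (x , y , z))        = ¬cross-separated f e x y z jf (swap je) ∘ swap
    ... | inj₂ (inj₂ (inj₁ (x , y , z))) = ¬cross-nested f e x y z (swap jf) (swap je) ∘ swap
    ... | inj₂ (inj₂ (inj₂ (x , y , z))) = ¬cross-separated e f x y z (swap je) jf

-- Packings

module _ {A : Set} where

  AllPairs-lookup : ∀ {R : A → A → Set} {xs} → AllPairs R xs →
                    ∀ {i j} → i Fin.< j → R (lookup xs i) (lookup xs j)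
  AllPairs-lookup (r ∷ _) {Fin.zero} {Fin.suc j} _ = All.lookup r (∈-lookup j)
  AllPairs-lookup (_ ∷ rs) {Fin.suc i} {Fin.suc j} i<j = AllPairs-lookup rs (s<s⁻¹ i<j)

  AllPairs-∈ : ∀ {R : A → A → Set} → (∀ {x y} → R x y → R y x) → ∀ {xs} → AllPairs R xs →
               ∀ {x y} → x ∈ xs → y ∈ xs → x ≡ y ⊎ R x y
  AllPairs-∈ _   (_ ∷ _)  (here refl) (here refl) = inj₁ refl
  AllPairs-∈ _   (r ∷ _)  (here refl) (there y∈)  = inj₂ (All.lookup r y∈)
  AllPairs-∈ sy  (r ∷ _)  (there x∈)  (here refl) = inj₂ (sy (All.lookup r x∈))
  AllPairs-∈ sy  (_ ∷ rs) (there x∈)  (there y∈)  = AllPairs-∈ sy rs x∈ y∈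

  -- Disjoint classes are hit at different positions, whence the bound; when it is attained,
  -- positions and classes correspond one to one. Used for blockers against parallel classes and for
  -- co-blockers against stars.
  module Packing {k : ℕ} (P : Fin k → A → Set) (disjoint : ∀ i j x → P i x → P j x → i ≡ j)
    (xs : List A) (hit : ∀ i → ∃ λ x → x ∈ xs × P i x) where

    private
      pos : Fin k → Fin (length xs)
      pos i = Any.index (proj₁ (proj₂ (hit i)))

      P-pos : ∀ i → P i (lookup xs (pos i))
      P-pos i = subst (P i) (lookup-index (proj₁ (proj₂ (hit i)))) (proj₂ (proj₂ (hit i)))

      pos-injective : ∀ {i j} → pos i ≡ pos j → i ≡ j
      pos-injective {i} {j} eq = disjoint i j _ (subst (P i ∘ lookup xs) eq (P-pos i)) (P-pos j)

    abstract

      k≤length : k ≤ length xs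
      k≤length = Fin.injective⇒≤ pos-injective

      module _ (tight : length xs ≡ k) where

        private
          pos-surjective : ∀ j → ∃ λ i → pos i ≡ j
          -- Adjoining j to the k positions hit makes k + 1 values in k places, and a coincidence
          -- must involve j.
          pos-surjective j with Fin.pigeonhole (s≤s (≤-reflexive tight)) f
            where
            f : Fin (suc k) → Fin (length xs)
            f Fin.zero    = j
            f (Fin.suc i) = pos i
          ... | Fin.zero  , Fin.suc i , _ , eq = i , sym eq
          ... | Fin.suc i , Fin.suc i′ , lt , eq = ⊥-elim (<⇒≢ (s<s⁻¹ lt) (cong toℕ (pos-injective eq)))

        class-of : ∀ {x} → x ∈ xs → ∃ λ i → P i x × lookup xs (pos i) ≡ x
        class-of {x} x∈ with i , eq ← pos-surjective (Any.index x∈) = i , subst (P i) eq′ (P-pos i) , eq′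
          where
          eq′ : lookup xs (pos i) ≡ x
          eq′ = trans (cong (lookup xs) eq) (sym (lookup-index x∈))

        unique-hit : ∀ {i x y} → x ∈ xs → y ∈ xs → P i x → P i y → x ≡ y
        unique-hit x∈ y∈ px py
          with j , pj , x≡ ← class-of x∈ with l , pl , y≡ ← class-of y∈
          with refl ← disjoint _ _ _ px pj with refl ← disjoint _ _ _ py pl = trans (sym x≡) y≡

unique⇒complete : ∀ {n} (xs : List (Fin n)) → Unique xs → length xs ≡ n → ∀ v → v ∈ xs
unique⇒complete {n} xs uniq len v with Fin.pigeonhole (s≤s (≤-reflexive (sym len))) f
  where
  f : Fin (suc (length xs)) → Fin n
  f Fin.zero    = v
  f (Fin.suc i) = lookup xs i
... | Fin.zero  , Fin.suc i  , _  , eq = subst (_∈ xs) (sym eq) (∈-lookup i)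
... | Fin.suc i , Fin.suc i′ , lt , eq = ⊥-elim (AllPairs-lookup uniq (s<s⁻¹ lt) eq)

disjoint-sym : ∀ {n} {e f : Edge n} → DisjointEdges e f → DisjointEdges f e
disjoint-sym {e = e} {f} (¬share , ¬cross) = ¬share ∘ share-sym f e , ¬cross ∘ cross-sym f e

disjoint⇒≢ : ∀ {n} {e f : Edge n} → DisjointEdges e f → e ≢ f
disjoint⇒≢ {e = e} (¬share , _) refl = ¬share (lo e , inj₁ refl , inj₁ refl)

-- Non-crossing shapes and their realisation

-- Shapes of non-crossing perfect matchings of an interval of 2k consecutive vertices.
infixr 5 _⊕_
data NC : ℕ → Set where
  ∅   : NC 0
  ⟨_⟩ : ∀ {k} → NC k → NC (suc k)
  _⊕_ : ∀ {j k} → NC j → NC k → NC (j + k)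

-- Arc T x a b: the shape T, placed on the interval starting at x, joins a to b.
data Arc : ∀ {k} → NC k → ℕ → ℕ → ℕ → Set where
  outer : ∀ {k} {T : NC k} {x} → Arc ⟨ T ⟩ x x (x + suc (k + k))
  inner : ∀ {k} {T : NC k} {x a b} → Arc T (suc x) a b → Arc ⟨ T ⟩ x a b
  left  : ∀ {j k} {S : NC j} {T : NC k} {x a b} → Arc S x a b → Arc (S ⊕ T) x a b
  right : ∀ {j k} {S : NC j} {T : NC k} {x a b} → Arc T (x + (j + j)) a b → Arc (S ⊕ T) x a b

private
  outer-end : ∀ x k → suc (x + suc (k + k)) ≡ x + (suc k + suc k)
  outer-end = solve-∀

  inner-end : ∀ x k b → suc b + (suc x + (k + k)) + 1 ≡ x + (suc k + suc k) + suc b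
  inner-end = solve-∀

  left-end : ∀ x j k b → suc b + (x + (j + j)) + (k + k) ≡ x + (j + k + (j + k)) + suc b
  left-end = solve-∀

  right-end : ∀ x j k → x + (j + j) + (k + k) ≡ x + (j + k + (j + k))
  right-end = solve-∀

  rainbow-end : ∀ x k → x + suc (k + k) ≡ x + suc k + k
  rainbow-end = solve-∀

  wrap-end : ∀ x k n → suc (x + suc (k + k)) + n + 0 ≡ x + n + (suc k + suc k)
  wrap-end = solve-∀

  append-end : ∀ x j k d n → suc d + (x + (j + j) + (k + k) + n) + 0 ≡ x + n + (suc d + (j + k + (j + k)))
  append-end = solve-∀

arc-bounds : ∀ {k} {T : NC k} {x a b} → Arc T x a b → x ≤ a × a < b × b < x + (k + k)
arc-bounds {x = x} (outer {k}) = ≤-refl , m<m+n x z<s , ≤-reflexive (outer-end x k)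
arc-bounds {x = x} {b = b} (inner {k} arc) with p , q , r ← arc-bounds arc =
  <⇒≤ p , q , lin 1 r (inner-end x k b)
arc-bounds {x = x} {b = b} (left {j} {k} arc) with p , q , r ← arc-bounds arc =
  p , q , lin (k + k) r (left-end x j k b)
arc-bounds {x = x} {b = b} (right {j} {k} arc) with p , q , r ← arc-bounds arc =
  ≤-trans (m≤m+n x (j + j)) p , q , ≤-trans r (≤-reflexive (right-end x j k))

rainbow : ∀ k → NC k
rainbow zero    = ∅
rainbow (suc k) = ⟨ rainbow k ⟩

-- `i` counts the arcs outside the given one and `j` those inside; depths are read off in this form.
rainbow-arc : ∀ k {x a b} → Arc (rainbow k) x a b →
              ∃₂ λ i j → suc (i + j) ≡ k × a ≡ x + i × b ≡ x + k + j
rainbow-arc (suc k) {x} outer = 0 , k , refl , sym (+-identityʳ x) , rainbow-end x k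
rainbow-arc (suc k) {x} (inner arc) with i , j , eq , refl , refl ← rainbow-arc k arc =
  suc i , j , cong suc eq , sym (+-suc x i) , cong (_+ j) (sym (+-suc x k))

module Matchings (n : ℕ) .{{_ : NonZero n}} where
  open Cyclic n

  ¬share-window : ∀ w {a b c d} (e f : Edge n) → Joins e (pt a) (pt b) → Joins f (pt c) (pt d) →
    (w ≤ a × a < w + n) → (w ≤ b × b < w + n) → (w ≤ c × c < w + n) → (w ≤ d × d < w + n) →
    a ≢ c → a ≢ d → b ≢ c → b ≢ d → ¬ ShareVertex e f
  ¬share-window w e f je jf (a₁ , a₂) (b₁ , b₂) (c₁ , c₂) (d₁ , d₂) ac ad bc bd (v , ve , vf)
    with incident-either e je ve | incident-either f jf vf
  ... | inj₁ refl | inj₁ eq = ac (pt-window′ a₁ a₂ c₁ c₂ eq)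
  ... | inj₁ refl | inj₂ eq = ad (pt-window′ a₁ a₂ d₁ d₂ eq)
  ... | inj₂ refl | inj₁ eq = bc (pt-window′ b₁ b₂ c₁ c₂ eq)
  ... | inj₂ refl | inj₂ eq = bd (pt-window′ b₁ b₂ d₁ d₂ eq)

  Placed : ∀ {k} → NC k → ℕ → Edge n → Set
  Placed T x e = ∃₂ λ a b → Arc T x a b × Joins e (pt a) (pt b)

  -- At most n consecutive points occur, so `pt` is injective on them; `arc-bounds` then keeps
  -- chords apart, by nesting under `⟨_⟩` and by separation under `_⊕_`.
  realise : ∀ {k} (T : NC k) x → k + k ≤ n →
            ∃ λ es → length es ≡ k × All (Placed T x) es × AllPairs DisjointEdges es
  realise ∅ x _ = [] , refl , [] , []
  realise (⟨_⟩ {k} T) x k≤n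
    with es , len , placed , disj ← realise T (suc x) (≤-trans (+-mono-≤ (n≤1+n k) (n≤1+n k)) k≤n)
    = e₀ ∷ es , cong suc len , (x , y , outer , je₀) ∷ All.map (λ {e} → weaken {e}) placed , All.map (λ {e} → apart {e}) placed ∷ disj
    where
    y = x + suc (k + k)
    x<y : x < y
    x<y = m<m+n x z<s
    y<x+n : y < x + n
    y<x+n = lin 0 k≤n (wrap-end x k n)
    e₀-joins = chord (pt x) (pt y) (λ eq → <⇒≢ x<y (pt-window′ ≤-refl (<-trans x<y y<x+n) (<⇒≤ x<y) y<x+n eq))
    e₀ = proj₁ e₀-joins
    je₀ = proj₂ e₀-joins
    weaken : ∀ {e} → Placed T (suc x) e → Placed ⟨ T ⟩ x e
    weaken (a , b , arc , j) = a , b , inner arc , j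
    apart : ∀ {e} → Placed T (suc x) e → DisjointEdges e₀ e
    apart {e} (a , b , arc , j) with x<a , a<b , b< ← arc-bounds arc =
      ¬share-window x e₀ e je₀ j (≤-refl , <-trans x<y y<x+n) (<⇒≤ x<y , y<x+n)
        (<⇒≤ x<a , <-trans a<b (<-trans b<y y<x+n)) (<⇒≤ (<-trans x<a a<b) , <-trans b<y y<x+n)
        (<⇒≢ x<a) (<⇒≢ (<-trans x<a a<b)) (≢-sym (<⇒≢ (<-trans a<b b<y))) (≢-sym (<⇒≢ b<y)) ,
      nested⇒¬cross e₀ e x<a a<b b<y y<x+n je₀ j
      where
      b<y : b < y
      b<y = ≤-trans b< (≤-reflexive (sym (+-suc x (k + k))))
  realise (_⊕_ {j} {k} S T) x jk≤n
    with es , len , placed , disj ← realise S x (≤-trans (+-mono-≤ (m≤m+n j k) (m≤m+n j k)) jk≤n)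
    with fs , len′ , placed′ , disj′ ← realise T (x + (j + j)) (≤-trans (+-mono-≤ (m≤n+m k j) (m≤n+m k j)) jk≤n)
    = es ++ fs , trans (length-++ es) (cong₂ _+_ len len′) ,
      All.++⁺ (All.map (λ {e} → weakenˡ {e}) placed) (All.map (λ {f} → weakenʳ {f}) placed′) ,
      AllPairs.++⁺ disj disj′ (All.map (λ {e} p → All.map (λ {f} → apart {e} {f} p) placed′) placed)
    where
    weakenˡ : ∀ {e} → Placed S x e → Placed (S ⊕ T) x e
    weakenˡ (a , b , arc , j) = a , b , left arc , j
    weakenʳ : ∀ {e} → Placed T (x + (j + j)) e → Placed (S ⊕ T) x e
    weakenʳ (a , b , arc , j) = a , b , right arc , j
    apart : ∀ {e f} → Placed S x e → Placed T (x + (j + j)) f → DisjointEdges e f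
    apart {e} {f} (a , b , arc , je) (c , d , arc′ , jf)
      with x≤a , a<b , b< ← arc-bounds arc with ≤c , c<d , d< ← arc-bounds arc′ =
      ¬share-window x e f je jf (x≤a , <-trans a<b (<-trans b<c c<)) (x≤b , <-trans b<c c<) (≤-trans x≤b (<⇒≤ b<c) , c<)
        (≤-trans x≤b (<⇒≤ (<-trans b<c c<d)) , d<x+n)
        (<⇒≢ (<-trans a<b b<c)) (<⇒≢ (<-trans a<b (<-trans b<c c<d))) (<⇒≢ b<c) (<⇒≢ (<-trans b<c c<d)) ,
      separated⇒¬cross e f a<b b<c c<d (≤-trans d<x+n (+-monoˡ-≤ n x≤a)) je jf
      where
      b<c : b < c
      b<c = ≤-trans b< ≤c
      d<x+n : d < x + n
      d<x+n = lin 0 (d< ⊞ jk≤n) (append-end x j k d n)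
      c< : c < x + n
      c< = <-trans c<d d<x+n
      x≤b : x ≤ b
      x≤b = ≤-trans x≤a (<⇒≤ a<b)

  -- Modulo n this labels the parallel class of a chord of the regular n-gon.
  sum : Edge n → ℕ
  sum e = toℕ (lo e) + toℕ (hi e)

  sum-joins : ∀ (e : Edge n) {x y} → Joins e (pt x) (pt y) → sum e % n ≡ (x + y) % n
  sum-joins e {x} {y} (inj₁ (p , q)) = trans
    (cong (_% n) (cong₂ _+_ (trans (cong toℕ p) (toℕ-pt x)) (trans (cong toℕ q) (toℕ-pt y))))
    (sym (%-distribˡ-+ x y n))
  sum-joins e {x} {y} (inj₂ (p , q)) = trans
    (cong (_% n) (cong₂ _+_ (trans (cong toℕ p) (toℕ-pt y)) (trans (cong toℕ q) (toℕ-pt x))))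
    (trans (sym (%-distribˡ-+ y x n)) (cong (_% n) (+-comm y x)))

-- Parity of orders

%2-+ : ∀ x k → (x + (k + k)) % 2 ≡ x % 2
%2-+ x k = trans (cong (λ y → (x + y) % 2) (lem k)) ([m+kn]%n≡m%n x k 2)
  where
  lem : ∀ k → k + k ≡ k * 2
  lem = solve-∀

odd-half : ∀ x → x % 2 ≡ 1 → ∃ λ τ → x ≡ suc (τ + τ)
odd-half x odd = x / 2 , trans (m≡m%n+[m/n]*n x 2) (trans (cong (_+ x / 2 * 2) odd) (lem (x / 2)))
  where
  lem : ∀ y → 1 + y * 2 ≡ suc (y + y)
  lem = solve-∀

module Parity (m : ℕ) .{{_ : NonZero (2 * m)}} where
  n = 2 * m
  open Cyclic n
  open Matchings n

  n≡m+m : n ≡ m + m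
  n≡m+m = cong (m +_) (+-identityʳ m)

  order-parity : ∀ (e : Edge n) → order e % 2 ≡ sum e % 2
  order-parity e = trans (case (⊓-sel d (n ∸ d))) (sym (trans (cong (_% 2) sum≡) (%2-+ d l)))
    where
    l = toℕ (lo e)
    h = toℕ (hi e)
    d = h ∸ l
    l+d : l + d ≡ h
    l+d = m+[n∸m]≡n (<⇒≤ (lo<hi e))
    sum≡ : sum e ≡ d + (l + l)
    sum≡ = trans (cong (l +_) (sym l+d)) (lem l d)
      where
      lem : ∀ l d → l + (l + d) ≡ d + (l + l)
      lem = solve-∀
    d≤n : d ≤ n
    d≤n = ≤-trans (m∸n≤m h l) (<⇒≤ (Fin.toℕ<n (hi e)))
    case : d ⊓ (n ∸ d) ≡ d ⊎ d ⊓ (n ∸ d) ≡ n ∸ d → order e % 2 ≡ d % 2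
    case (inj₁ eq) = cong (_% 2) eq
    case (inj₂ eq) = trans (cong (_% 2) eq) (begin
      (n ∸ d) % 2           ≡⟨ %2-+ (n ∸ d) d ⟨
      (n ∸ d + (d + d)) % 2 ≡⟨ cong (_% 2) (trans (sym (+-assoc (n ∸ d) d d)) (cong (_+ d) (m∸n+n≡m d≤n))) ⟩
      (n + d) % 2           ≡⟨ cong (_% 2) (trans (cong (_+ d) n≡m+m) (+-comm (m + m) d)) ⟩
      (d + (m + m)) % 2     ≡⟨ %2-+ d m ⟩
      d % 2                 ∎)
      where open ≡-Reasoning

  -- The order of a chord has the parity of any difference of its endpoints, since n is even.
  order-joins : ∀ (e : Edge n) {v x} → Joins e (pt v) (pt (v + x)) → order e % 2 ≡ x % 2
  order-joins e {v} {x} j = begin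
    order e % 2           ≡⟨ order-parity e ⟩
    sum e % 2             ≡⟨ m∣n⇒o%n%m≡o%m 2 n (sum e) (divides m (*-comm 2 m)) ⟨
    sum e % n % 2         ≡⟨ cong (_% 2) (sum-joins e j) ⟩
    (v + (v + x)) % n % 2 ≡⟨ m∣n⇒o%n%m≡o%m 2 n (v + (v + x)) (divides m (*-comm 2 m)) ⟩
    (v + (v + x)) % 2     ≡⟨ cong (_% 2) (lem v x) ⟩
    (x + (v + v)) % 2     ≡⟨ %2-+ x v ⟩
    x % 2                 ∎
    where
    open ≡-Reasoning
    lem : ∀ v x → v + (v + x) ≡ x + (v + v)
    lem = solve-∀

  -- An odd edge seen from its end v, with 2τ vertices strictly between on the positive side. Seen
  -- from its other end it has parameter m - 1 - τ, when τ < m.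
  Spoke : ℕ → ℕ → Edge n → Set
  Spoke v τ e = Joins e (pt v) (pt (v + suc (τ + τ)))

  spoke-odd : ∀ (e : Edge n) {v τ} → Spoke v τ e → OddOrder e
  spoke-odd e {v} {τ} j = trans (order-joins e j) (%2-+ 1 τ)

  half<m : ∀ {τ} → suc (τ + τ) < n → τ < m
  half<m {τ} lt with τ <? m
  ... | yes p = p
  ... | no ¬p = ⊥-elim (<⇒≱ lt (≤-trans (≤-reflexive n≡m+m) (≤-trans (+-mono-≤ (≮⇒≥ ¬p) (≮⇒≥ ¬p)) (n≤1+n _))))

  odd⇒spoke : ∀ (e : Edge n) v → OddOrder e → Incident (pt v) e → ∃ λ τ → τ < m × Spoke v τ e
  odd⇒spoke e v odd inc
    with y , j ← incident⇒joins e inc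
    with x , x<n , refl ← offset v y
    with τ , refl ← odd-half x (trans (sym (order-joins e j)) odd) = τ , half<m x<n , j

-- Simple perfect matchings have odd edges only

endpoints : ∀ {n} → List (Edge n) → List (Fin n)
endpoints []       = []
endpoints (e ∷ es) = lo e ∷ hi e ∷ endpoints es

length-endpoints : ∀ {n} (es : List (Edge n)) → length (endpoints es) ≡ 2 * length es
length-endpoints []       = refl
length-endpoints (e ∷ es) = trans (cong (suc ∘ suc) (length-endpoints es)) (lem (length es))
  where
  lem : ∀ x → suc (suc (2 * x)) ≡ 2 * suc x
  lem = solve-∀

∈-endpoints : ∀ {n} {v : Fin n} es → v ∈ endpoints es → ∃ λ e → e ∈ es × Incident v e
∈-endpoints (e ∷ es) (here refl)         = e , here refl , inj₁ refl
∈-endpoints (e ∷ es) (there (here refl)) = e , here refl , inj₂ refl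
∈-endpoints (e ∷ es) (there (there v∈)) with f , f∈ , inc ← ∈-endpoints es v∈ = f , there f∈ , inc

endpoints-unique : ∀ {n} {es : List (Edge n)} → AllPairs DisjointEdges es → Unique (endpoints es)
endpoints-unique [] = []
endpoints-unique {es = e ∷ es} (r ∷ rs) =
  ((λ eq → <⇒≢ (lo<hi e) (cong toℕ eq)) ∷ fresh (lo e) (inj₁ refl)) ∷ fresh (hi e) (inj₂ refl) ∷ endpoints-unique rs
  where
  fresh : ∀ v → Incident v e → All (v ≢_) (endpoints es)
  fresh v inc = All.tabulate λ { v∈ refl → let f , f∈ , inc′ = ∈-endpoints es v∈
                                            in proj₁ (All.lookup r f∈) (v , inc , inc′) }

module SimpleMatching (m : ℕ) (M : EdgeSet (2 * m)) (len : length M ≡ m)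
  (disjoint : AllPairs DisjointEdges M) where

  covered : ∀ v → ∃ λ e → e ∈ M × Incident v e
  covered v = ∈-endpoints M (unique⇒complete (endpoints M) (endpoints-unique disjoint)
    (trans (length-endpoints M) (cong (2 *_) len)) v)

  ≡⊎disjoint : ∀ {e f} → e ∈ M → f ∈ M → e ≡ f ⊎ DisjointEdges e f
  ≡⊎disjoint = AllPairs-∈ (λ {e f} → disjoint-sym {e = e} {f}) disjoint

  share⇒≡ : ∀ {e f} → e ∈ M → f ∈ M → ShareVertex e f → e ≡ f
  share⇒≡ e∈ f∈ s with ≡⊎disjoint e∈ f∈
  ... | inj₁ eq          = eq
  ... | inj₂ (¬share , _) = ⊥-elim (¬share s)

  ¬cross : ∀ {e f} → e ∈ M → f ∈ M → ¬ Cross e f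
  ¬cross {e} {f} e∈ f∈ x with ≡⊎disjoint e∈ f∈
  ... | inj₁ refl       = cross⇒¬share e e x (lo e , inj₁ refl , inj₁ refl)
  ... | inj₂ (_ , ¬x)   = ¬x x

  private
    OddSpan : Edge (2 * m) → Set
    OddSpan e = ∃ λ j → toℕ (hi e) ≡ toℕ (lo e) + suc (j + j)

    shorter-eq : ∀ w y x z l k → w + (y + (x + suc k + (z + l))) + 1 ≡ l + k + (suc w + (y + (suc x + z)))
    shorter-eq = solve-∀

    odd+odd : ∀ x i j → suc (x + suc (j + j) + suc (i + i)) ≡ x + suc (suc (j + i) + suc (j + i))
    odd+odd = solve-∀

  -- The vertices strictly between the ends of an edge are matched among themselves;
  -- they are traversed from left to right, skipping the edges inside one after the other.
  module _ (k : ℕ) (rec : ∀ f → f ∈ M → toℕ (hi f) ≤ toℕ (lo f) + k → OddSpan f)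
    (e : Edge (2 * m)) (e∈ : e ∈ M) (bound : toℕ (hi e) ≤ toℕ (lo e) + suc k) where

    private
      x y : ℕ
      x = toℕ (lo e)
      y = toℕ (hi e)

    -- Loop invariant of `traverse`: it prevents the edge at z from having its other end strictly
    -- between x and z.
    Closed : ℕ → Set
    Closed z = ∀ f → f ∈ M → x < toℕ (lo f) → toℕ (lo f) < z → toℕ (hi f) < z

    traverse : ∀ d j z → z ≡ x + suc (j + j) → z ≤ y → y ≤ z + d → Closed z → OddSpan e
    traverse d j z z≡ z≤y y≤ closed with z ≟ y
    ... | yes refl = j , z≡
    traverse zero j z z≡ z≤y y≤ closed | no z≢y = ⊥-elim (z≢y (≤-antisym z≤y (≤-trans y≤ (≤-reflexive (+-identityʳ z)))))
    traverse (suc d) j z z≡ z≤y y≤ closed | no z≢y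
      with f , f∈ , inc ← covered (fromℕ< (<-trans (≤∧≢⇒< z≤y z≢y) (Fin.toℕ<n (hi e)))) = case inc
      where
      z<y : z < y
      z<y = ≤∧≢⇒< z≤y z≢y
      v : Fin (2 * m)
      v = fromℕ< (<-trans z<y (Fin.toℕ<n (hi e)))
      v≡ : toℕ v ≡ z
      v≡ = Fin.toℕ-fromℕ< _
      x<z : x < z
      x<z = ≤-trans (m<m+n x z<s) (≤-reflexive (sym z≡))
      case : Incident v f → OddSpan e
      case (inj₂ hi≡) with <-cmp (toℕ (lo f)) x
      ... | tri< lt _ _ = ⊥-elim (¬cross e∈ f∈ (inj₂ (lt , subst (x <_) (sym hi≡z) x<z , subst (_< y) (sym hi≡z) z<y)))
        where
        hi≡z : toℕ (hi f) ≡ z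
        hi≡z = trans (cong toℕ hi≡) v≡
      ... | tri≈ _ eq _ = ⊥-elim (<⇒≢ z<y (trans (sym (trans (cong toℕ hi≡) v≡))
                (cong (toℕ ∘ hi) (sym (share⇒≡ e∈ f∈ (lo e , inj₁ refl , inj₁ (Fin.toℕ-injective eq)))))))
      ... | tri> _ _ gt = ⊥-elim (<-irrefl hi≡z (closed f f∈ gt (subst (toℕ (lo f) <_) hi≡z (lo<hi f))))
        where
        hi≡z : toℕ (hi f) ≡ z
        hi≡z = trans (cong toℕ hi≡) v≡
      case (inj₁ lo≡) with <-cmp (toℕ (hi f)) y
      ... | tri≈ _ eq _ = ⊥-elim (<⇒≢ x<z (trans
                (cong (toℕ ∘ lo) (share⇒≡ e∈ f∈ (hi e , inj₂ refl , inj₂ (Fin.toℕ-injective eq))))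
                (trans (cong toℕ lo≡) v≡)))
      ... | tri> _ _ gt = ⊥-elim (¬cross e∈ f∈ (inj₁ (subst (x <_) (sym lo≡z) x<z , subst (_< y) (sym lo≡z) z<y , gt)))
        where
        lo≡z : toℕ (lo f) ≡ z
        lo≡z = trans (cong toℕ lo≡) v≡
      -- The edge at z is shorter than e, so it has an odd span 2i + 1; the traversal resumes at z +
      -- 2i + 2, at an odd offset from x again.
      ... | tri< w<y _ _ with i , hi≡ ← rec f f∈ (lin 1 (w<y ⊞ bound ⊞ x<z ⊞ ≤-reflexive (sym (trans (cong toℕ lo≡) v≡)))
                                 (shorter-eq (toℕ (hi f)) y x z (toℕ (lo f)) k)) =
        traverse d (suc (j + i)) (suc (toℕ (hi f))) (z′≡ hi≡) w<y
          (≤-trans y≤ (≤-trans (≤-reflexive (+-suc z d)) (s≤s (+-monoˡ-≤ d (<⇒≤ z<w))))) closed′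
        where
        lo≡z : toℕ (lo f) ≡ z
        lo≡z = trans (cong toℕ lo≡) v≡
        z<w : z < toℕ (hi f)
        z<w = subst (_< toℕ (hi f)) lo≡z (lo<hi f)
        z′≡ : toℕ (hi f) ≡ toℕ (lo f) + suc (i + i) → suc (toℕ (hi f)) ≡ x + suc (suc (j + i) + suc (j + i))
        z′≡ hi≡ = trans (cong suc (trans hi≡ (cong (_+ suc (i + i)) (trans lo≡z z≡)))) (odd+odd x i j)
        closed′ : Closed (suc (toℕ (hi f)))
        closed′ g g∈ x<g g<z′ with <-cmp (toℕ (lo g)) z
        ... | tri< lt _ _ = <-trans (closed g g∈ x<g lt) (≤-trans z<w (n≤1+n _))
        ... | tri≈ _ eq _ = s≤s (≤-reflexive (cong (toℕ ∘ hi) (share⇒≡ g∈ f∈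
              (lo f , inj₁ (Fin.toℕ-injective (trans eq (sym lo≡z))) , inj₁ refl))))
        ... | tri> _ _ gt with toℕ (lo g) ≟ toℕ (hi f) | <-cmp (toℕ (hi g)) (toℕ (hi f))
        ...   | yes eq | _ = ⊥-elim (<⇒≢ gt (trans (sym lo≡z) (cong (toℕ ∘ lo) (share⇒≡ f∈ g∈
                (hi f , inj₂ refl , inj₁ (Fin.toℕ-injective eq))))))
        ...   | no _   | tri< lt _ _ = ≤-trans lt (n≤1+n _)
        ...   | no _   | tri≈ _ eq _ = s≤s (≤-reflexive eq)
        ...   | no ≢   | tri> _ _ >hi = ⊥-elim (¬cross f∈ g∈ (inj₁
                (subst (_< toℕ (lo g)) (sym lo≡z) gt , ≤∧≢⇒< (≤-pred g<z′) ≢ , >hi)))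

  odd-span : ∀ k e → e ∈ M → toℕ (hi e) ≤ toℕ (lo e) + k → OddSpan e
  odd-span zero    e e∈ bound = ⊥-elim (<⇒≱ (lo<hi e) (≤-trans bound (≤-reflexive (+-identityʳ _))))
  odd-span (suc k) e e∈ bound = traverse k (odd-span k) e e∈ bound (toℕ (hi e)) 0 (suc (toℕ (lo e)))
    (sym (+-comm (toℕ (lo e)) 1)) (lo<hi e) (m≤n+m _ _)
    (λ f _ lt lt′ → ⊥-elim (<⇒≱ lt (≤-pred lt′)))

-- Blockers and co-blockers

double-injective : ∀ {i j} → i + i ≡ j + j → i ≡ j
double-injective {i} {j} eq with <-cmp i j
... | tri< lt _ _ = ⊥-elim (<⇒≢ (+-mono-< lt lt) eq)
... | tri≈ _ p _  = p
... | tri> _ _ gt = ⊥-elim (<⇒≢ (+-mono-< gt gt) (sym eq))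

odd≢even : ∀ i j → suc (i + i) ≢ j + j
odd≢even i j eq with trans (sym (%2-+ 1 i)) (trans (cong (_% 2) eq) (%2-+ 0 j))
... | ()

private
  next-odd : ∀ v τ → suc v + suc (τ + τ) ≡ v + (suc τ + suc τ)
  next-odd = solve-∀

  chord-sum : ∀ κ t s → suc κ + t + (suc κ + suc (t + s) + s) ≡ suc (κ + κ) + 2 * suc (t + s)
  chord-sum = solve-∀

  reduce-dir : ∀ r q m → suc (r + q * m + (r + q * m)) ≡ suc (r + r) + q * (2 * m)
  reduce-dir = solve-∀

  antipodal-end : ∀ κ m t → suc (κ + m) + m + t ≡ suc κ + t + 2 * m
  antipodal-end = solve-∀

  first-lo : ∀ κ m r i → suc κ + m + suc r + i ≡ suc κ + m + (r + suc i)
  first-lo = solve-∀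

  first-hi : ∀ κ p r j → suc κ + (p + suc r) + suc r + p + j ≡ suc κ + j + 2 * (p + suc r)
  first-hi = solve-∀

  first-size : ∀ i j r → suc (j + (r + suc i)) ≡ suc (i + j) + suc r
  first-size = solve-∀

  middle-lo : ∀ κ m p r → suc κ + m + suc r + (p + p) ≡ suc (suc (κ + p)) + m + (p + r)
  middle-lo = solve-∀

  middle-hi : ∀ κ p r → suc κ + (p + suc r) + suc r + (p + p) + 1 ≡ suc (suc (κ + p)) + 0 + 2 * (p + suc r)
  middle-hi = solve-∀

  last-lo : ∀ κ p r i → suc κ + (p + suc r) + suc r + (p + p) + 2 + i ≡ suc (suc κ) + (suc (p + i)) + 2 * (p + suc r)
  last-lo = solve-∀

  last-hi : ∀ κ p r j → suc κ + (p + suc r) + suc r + (p + p) + 2 + r + j ≡ suc (suc κ) + (p + suc r) + j + 2 * (p + suc r)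
  last-hi = solve-∀

  last-size : ∀ p i j → suc (suc (p + i) + j) ≡ p + suc (suc (i + j))
  last-size = solve-∀

  near-sum : ∀ w j → suc w + (w + (j + j)) ≡ suc (w + w) + (j + j)
  near-sum = solve-∀

  spoke-end : ∀ v τ → suc (v + τ) + τ ≡ v + suc (τ + τ)
  spoke-end = solve-∀

  antipodal-spoke : ∀ v τ s → suc (v + τ) + suc (τ + s) + s ≡ v + 2 * suc (τ + s)
  antipodal-spoke = solve-∀

  around : ∀ x v → v + (v + x) ≡ x + (v + v)
  around = solve-∀

  far-sum : ∀ w j → w + (w + suc (j + j)) ≡ suc (w + w) + (j + j)
  far-sum = solve-∀

_≟ᵉ_ : ∀ {n} (e f : Edge n) → Dec (e ≡ f)
e ≟ᵉ f with lo e Fin.≟ lo f | hi e Fin.≟ hi f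
... | yes p | yes q = yes (edge-≡ p q)
... | no ¬p | _     = no (¬p ∘ cong lo)
... | yes _ | no ¬q = no (¬q ∘ cong hi)

module Polygon (m : ℕ) .{{_ : NonZero m}} where

  private instance
    2m≢0 : NonZero (2 * m)
    2m≢0 = m*n≢0 2 m

  open Parity m
  open Cyclic n
  open Matchings n

  2*<n : ∀ {i} → i < m → i + i < n
  2*<n i<m = ≤-trans (+-mono-< i<m i<m) (≤-reflexive (sym n≡m+m))

  odd<n : ∀ {i} → i < m → suc (i + i) < n
  odd<n {i} i<m = ≤-trans (≤-trans (≤-reflexive (cong suc (sym (+-suc i i)))) (+-mono-≤ i<m i<m)) (≤-reflexive (sym n≡m+m))

  pt-parity : ∀ {x y} → pt x ≡ pt y → x % 2 ≡ y % 2
  pt-parity {x} {y} eq = trans (sym (m∣n⇒o%n%m≡o%m 2 n x 2∣n)) (trans (cong (_% 2)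
      (trans (sym (toℕ-pt x)) (trans (cong toℕ eq) (toℕ-pt y)))) (m∣n⇒o%n%m≡o%m 2 n y 2∣n))
    where
    2∣n : 2 ∣ n
    2∣n = divides m (*-comm 2 m)

  1<n : 1 < n
  1<n = ≤-trans (+-mono-≤ (>-nonZero⁻¹ m) (>-nonZero⁻¹ m)) (≤-reflexive (sym n≡m+m))

  -- If τ > 0 and τ′ ≥ τ, the ends v, v + 1, v + 2τ + 1, v + 2τ′ + 2 interleave. The exception is τ′
  -- = m - 1, where f returns to v; then e = f joins v to v + 1, against τ > 0.
  spoke-step : ∀ {v τ τ′} (e f : Edge n) → τ < m → τ′ < m → ¬ Cross e f → (ShareVertex e f → e ≡ f) →
               Spoke v τ e → Spoke (suc v) τ′ f → τ ≡ 0 ⊎ τ′ < τ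
  spoke-step {v} {zero} e f _ _ _ _ _ _ = inj₁ refl
  spoke-step {v} {suc τ} {τ′} e f τ<m τ′<m ¬x share je jf with τ′ <? suc τ | suc τ′ <? m
  ... | yes p | _ = inj₂ p
  ... | no τ′≮ | yes p = ⊥-elim (¬x (interleaved⇒cross e f (n<1+n v)
        (≤-trans (≤-reflexive (sym (+-comm v 2))) (+-monoʳ-≤ v (s≤s (s≤s z≤n))))
        (≤-trans (s≤s (+-monoʳ-≤ v (s≤s (+-mono-≤ (≮⇒≥ τ′≮) (≮⇒≥ τ′≮))))) ≤-refl)
        (≤-trans (≤-reflexive (cong suc (next-odd v τ′))) (+-monoʳ-< v (2*<n p))) je jf))
  ... | no τ′≮ | no ¬p = ⊥-elim (1≢ (pt-window v 1<n (odd<n τ<m) (trans (cong pt (+-comm v 1)) (joins-other e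
            (subst (λ g → Joins g (pt v) (pt (suc v))) (sym e≡f) jf′) je))))
    where
    1≢ : 1 ≢ suc (suc τ + suc τ)
    1≢ ()
    end : pt (suc v + suc (τ′ + τ′)) ≡ pt v
    end = trans (cong pt (trans (next-odd v τ′) (cong (v +_) (trans (cong₂ _+_ τ′≡ τ′≡) (sym n≡m+m))))) (pt-+n v)
      where
      τ′≡ : suc τ′ ≡ m
      τ′≡ = ≤-antisym τ′<m (≮⇒≥ ¬p)
    jf′ : Joins f (pt v) (pt (suc v))
    jf′ = joins-sym f (subst (Joins f (pt (suc v))) end jf)
    e≡f : e ≡ f
    e≡f = share (pt v , joins⇒incident e je , joins⇒incident f jf′)

  -- The common ground of simple perfect matchings and matchings as in (i), (ii): enough to be met
  -- by all double stars and to meet every blocking set of m edges.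
  record Walkable (M : EdgeSet n) : Set where
    field
      spoke : ∀ v → ∃₂ λ τ e → τ < m × e ∈ M × Spoke v τ e
      step  : ∀ {v τ τ′ e f} → e ∈ M → f ∈ M → τ < m → τ′ < m →
              Spoke v τ e → Spoke (suc v) τ′ f → τ ≡ 0 ⊎ τ′ < τ

  spm-walkable : ∀ {M} → IsSPM m M → Walkable M
  spm-walkable {M} (_ , len , disj) = record
    { spoke = λ v → let e , e∈ , inc = covered (pt v)
                        j , hi≡ = odd-span (toℕ (hi e)) e e∈ (m≤n+m _ _)
                        τ , τ<m , s = odd⇒spoke e v (odd e j hi≡) inc
                    in τ , e , τ<m , e∈ , s
    ; step = λ {_} {_} {_} {e} {f} e∈ f∈ τ<m τ′<m → spoke-step e f τ<m τ′<m (¬cross e∈ f∈) (share⇒≡ e∈ f∈)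
    }
    where
    open SimpleMatching m M len disj
    odd : ∀ e j → toℕ (hi e) ≡ toℕ (lo e) + suc (j + j) → OddOrder e
    odd e j hi≡ = spoke-odd e {τ = j} (inj₁ (sym (pt-toℕ (lo e)) , trans (sym (pt-toℕ (hi e))) (cong pt hi≡)))

  suc-% : ∀ v → suc v % n ≡ suc (v % n) % n
  suc-% v = trans (%-distribˡ-+ 1 v n) (cong (λ r → (r + v % n) % n) (m<n⇒m%n≡m 1<n))

  adjacent-suc : ∀ v → Adjacent (pt v) (pt (suc v))
  adjacent-suc v with suc (v % n) <? n
  ... | yes lt = inj₁ (trans (cong suc (toℕ-pt v)) (sym (trans (toℕ-pt (suc v)) (trans (suc-% v) (m<n⇒m%n≡m lt)))))
  ... | no ¬lt = inj₂ (inj₂ (inj₂ (trans (toℕ-pt (suc v)) (trans (suc-% v) (trans (cong (_% n) top) (n%n≡0 n))) ,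
                                   trans (cong suc (toℕ-pt v)) top)))
    where
    top : suc (v % n) ≡ n
    top = ≤-antisym (m%n<n v n) (≮⇒≥ ¬lt)

  adjacent⇒suc : ∀ a b → Adjacent a b → b ≡ pt (suc (toℕ a)) ⊎ a ≡ pt (suc (toℕ b))
  adjacent⇒suc a b (inj₁ eq)               = inj₁ (trans (sym (pt-toℕ b)) (cong pt (sym eq)))
  adjacent⇒suc a b (inj₂ (inj₁ eq))        = inj₂ (trans (sym (pt-toℕ a)) (cong pt (sym eq)))
  adjacent⇒suc a b (inj₂ (inj₂ (inj₁ (z , eq)))) =
    inj₂ (trans (trans (sym (pt-toℕ a)) (cong pt z)) (sym (trans (cong pt eq) (pt-+n 0))))
  adjacent⇒suc a b (inj₂ (inj₂ (inj₂ (z , eq)))) =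
    inj₁ (trans (trans (sym (pt-toℕ b)) (cong pt z)) (sym (trans (cong pt eq) (pt-+n 0))))

  coherent-walkable : ∀ {C} → IsPerfectMatching m C → All OddOrder C → NoAdjacentCrossing C → Walkable C
  coherent-walkable {C} (_ , _ , matched) odd nac = record
    { spoke = λ v → let e , e∈ , inc , _ = matched (pt v)
                        τ , τ<m , s = odd⇒spoke e v (All.lookup odd e∈) inc
                    in τ , e , τ<m , e∈ , s
    ; step = λ {v} {_} {_} {e} {f} e∈ f∈ τ<m τ′<m je jf → spoke-step e f τ<m τ′<m
        (nac e f e∈ f∈ _ _ _ _ je jf (adjacent-suc v)) (share e∈ f∈) je jf
    }
    where
    share : ∀ {e f} → e ∈ C → f ∈ C → ShareVertex e f → e ≡ f
    share e∈ f∈ (v , ve , vf) = let _ , _ , _ , uniq = matched v in trans (uniq _ e∈ ve) (sym (uniq _ f∈ vf))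

  -- The profile of a minimum blocker

  Blocking : EdgeSet n → Set
  Blocking B = ∀ S → IsSPM m S → Meets B S

  abstract
    spm-of : ∀ {k} (T : NC k) → k ≡ m → ∀ x → ∃ λ S → IsSPM m S × All (Placed T x) S
    spm-of T refl x with S , len , placed , disj ← realise T x (≤-reflexive (sym n≡m+m)) =
      S , (AllPairs.map disjoint⇒≢ disj , len , disj) , placed

  abstract
    placed-hit : ∀ {B k} → Blocking B → (T : NC k) → k ≡ m → ∀ x → ∃ λ e → e ∈ B × Placed T x e
    placed-hit blocking T k≡m x
      with S , spm , placed ← spm-of T k≡m x
      with e , e∈B , e∈S ← blocking S spm = e , e∈B , All.lookup placed e∈S

  -- Chord κ t s e, where t + s + 1 = m: e is perpendicular to the axis through the midpoint of the
  -- boundary edge [κ , κ+1], and t (resp. s) chords with that property lie between e and that edge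
  -- (resp. its antipode).
  Chord : ℕ → ℕ → ℕ → Edge n → Set
  Chord κ t s e = Joins e (pt (suc κ + t)) (pt (suc κ + m + s))

  Direction : ℕ → Edge n → Set
  Direction κ e = sum e % n ≡ suc (κ + κ) % n

  chord-direction : ∀ κ t s (e : Edge n) → suc (t + s) ≡ m → Chord κ t s e → Direction κ e
  chord-direction κ t s e refl j = trans (sum-joins e {suc κ + t} {suc κ + suc (t + s) + s} j)
    (trans (cong (_% n) (chord-sum κ t s)) ([m+n]%n≡m%n (suc (κ + κ)) n))

  abstract
    chord-hit : ∀ {B} → Blocking B → ∀ κ → ∃₂ λ t s → suc (t + s) ≡ m × ∃ λ e → e ∈ B × Chord κ t s e
    chord-hit blocking κ
      -- The rainbow of m arcs starting at κ + 1 is the whole parallel class of [κ , κ+1].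
      with e , e∈ , _ , _ , arc , j ← placed-hit blocking (rainbow m) refl (suc κ)
      with t , s , ts , refl , refl ← rainbow-arc m arc = t , s , ts , e , e∈ , j

  direction-hit : ∀ B → Blocking B → ∀ κ → ∃ λ e → e ∈ B × Direction κ e
  direction-hit B blocking κ =
    let t , s , ts , e , e∈ , j = chord-hit blocking κ in e , e∈ , chord-direction κ t s e ts j

  directions-disjoint : ∀ i j e → Direction (toℕ i) e → Direction (toℕ j) e → i ≡ j
  directions-disjoint i j _ p q = Fin.toℕ-injective (double-injective
    (%-window 1 (2*<n (Fin.toℕ<n i)) (2*<n (Fin.toℕ<n j)) (trans (sym p) q)))

  module Directions B (blocking : Blocking B) =
    Packing (λ i → Direction (toℕ i)) directions-disjoint B (λ i → direction-hit B blocking (toℕ i))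

  module Minimum {B} (blocking : Blocking B) (len : length B ≡ m) where

    same-direction : ∀ κ {e f} → e ∈ B → f ∈ B → Direction κ e → Direction κ f → e ≡ f
    -- 2κ + 1 modulo 2m depends only on κ modulo m.
    same-direction κ e∈ f∈ p q = Directions.unique-hit B blocking len {i = fromℕ< (m%n<n κ m)} e∈ f∈ (trans p reduce) (trans q reduce)
      where
      reduce : suc (κ + κ) % n ≡ suc (toℕ (fromℕ< (m%n<n κ m)) + toℕ (fromℕ< (m%n<n κ m))) % n
      reduce rewrite Fin.toℕ-fromℕ< (m%n<n κ m) = trans
        (cong (λ x → suc (x + x) % n) (m≡m%n+[m/n]*n κ m))
        (trans (cong (_% n) (reduce-dir (κ % m) (κ / m) m)) ([m+kn]%n≡m%n (suc (κ % m + κ % m)) (κ / m) n))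

    t s : ℕ → ℕ
    t κ = proj₁ (chord-hit blocking κ)
    s κ = proj₁ (proj₂ (chord-hit blocking κ))

    t+s : ∀ κ → suc (t κ + s κ) ≡ m
    t+s κ = proj₁ (proj₂ (proj₂ (chord-hit blocking κ)))

    chord∈ : ∀ κ → ∃ λ e → e ∈ B × Chord κ (t κ) (s κ) e
    chord∈ κ = proj₂ (proj₂ (proj₂ (chord-hit blocking κ)))

    -- The class holds one edge of the blocker. One end lies among the m vertices from κ + 1 on and
    -- determines the depth; the other lies in the opposite half, so orientations cannot be
    -- confused.
    t-unique : ∀ κ {t′ s′ e} → suc (t′ + s′) ≡ m → e ∈ B → Chord κ t′ s′ e → t κ ≡ t′
    t-unique κ {t′} {s′} {e} ts′ e∈ j
      with f , f∈ , j′ ← chord∈ κ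
      with refl ← same-direction κ e∈ f∈ (chord-direction κ t′ s′ e ts′ j) (chord-direction κ (t κ) (s κ) f (t+s κ) j′) = go j j′
      where
      <m : ∀ {x y} → suc (x + y) ≡ m → x < m
      <m eq = ≤-trans (s≤s (m≤m+n _ _)) (≤-reflexive eq)
      <n : ∀ {x y} → suc (x + y) ≡ m → x < n
      <n eq = <-trans (<m eq) (m<m+n m (≤-trans (>-nonZero⁻¹ m) (m≤m+n m 0)))
      far : ∀ {x y} → suc (x + y) ≡ m → m + y < n
      far {x} {y} eq = +-monoʳ-< m (≤-trans (≤-trans (s≤s (m≤n+m y x)) (≤-reflexive eq)) (m≤m+n m 0))
      clash : ∀ {x y z w} → suc (x + y) ≡ m → suc (z + w) ≡ m → pt (suc κ + x) ≡ pt (suc κ + m + w) → ⊥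
      clash {x} {y} {z} {w} xy zw eq = <⇒≢ (≤-trans (<m xy) (m≤m+n m w))
        (pt-window (suc κ) (<n xy) (far zw) (trans eq (cong pt (+-assoc (suc κ) m w))))
      go : Chord κ t′ s′ e → Chord κ (t κ) (s κ) e → t κ ≡ t′
      go (inj₁ (p , _)) (inj₁ (q , _)) = pt-window (suc κ) (<n (t+s κ)) (<n ts′) (trans (sym q) p)
      go (inj₁ (p , _)) (inj₂ (q , _)) = ⊥-elim (clash ts′ (t+s κ) (trans (sym p) q))
      go (inj₂ (p , _)) (inj₁ (q , _)) = ⊥-elim (clash (t+s κ) ts′ (trans (sym q) p))
      go (inj₂ (_ , p)) (inj₂ (_ , q)) = pt-window (suc κ) (<n (t+s κ)) (<n ts′) (trans (sym q) p)

    -- The same chord read from the opposite boundary edge, with `t` and `s` exchanged.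
    antipode : ∀ κ → suc (t (κ + m) + t κ) ≡ m
    antipode κ with e , e∈ , j ← chord∈ κ = trans (cong (λ x → suc (x + t κ)) (t-unique (κ + m) s+t e∈
        (joins-sym e (subst (λ x → Joins e x (pt (suc κ + m + s κ)))
          (sym (trans (cong pt (antipodal-end κ m (t κ))) (pt-+n (suc κ + t κ)))) j)))) s+t
      where
      s+t : suc (s κ + t κ) ≡ m
      s+t = trans (cong suc (+-comm (s κ) (t κ))) (t+s κ)

    -- Three nested families side by side form a simple perfect matching: p chords around
    -- [κ , κ+1], one boundary edge, and m − 1 − p chords around the antipode of [κ+1 , κ+2].
    turn : ∀ κ p → p < m → p ≤ t κ → t (suc κ) ≤ p → t (suc (κ + p)) ≡ 0
    turn κ p p<m p≤ ≤p with r ← m ∸ suc p | pr ← trans (+-suc p (m ∸ suc p)) (m+[n∸m]≡n p<m)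
      -- As r = m - 1 - p, the starting point is κ + 1 - p modulo 2m.
      with placed-hit blocking (rainbow p ⊕ ⟨ ∅ ⟩ ⊕ rainbow r) pr (suc κ + m + suc r)
    -- An edge of the first family has depth l < p below [κ , κ+1], one of the last has depth p + 1
    -- + i below [κ+1 , κ+2]; both are excluded, which leaves the boundary edge at κ + p + 1.
    ... | e , e∈ , _ , _ , left arc , j
      with i , l , refl , refl , refl ← rainbow-arc p arc =
      ⊥-elim (<⇒≱ (s≤s (m≤n+m l i)) (≤-trans p≤ (≤-reflexive (t-unique κ (trans (first-size i l r) pr) e∈
        (joins-sym e (subst₂ (Joins e) (cong pt (first-lo κ m r i)) hi≡ j))))))
      where
      hi≡ : pt (suc κ + m + suc r + suc (i + l) + l) ≡ pt (suc κ + l)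
      hi≡ = trans (cong pt (subst (λ m → suc κ + m + suc r + suc (i + l) + l ≡ suc κ + l + 2 * m) pr
              (first-hi κ (suc (i + l)) r l))) (pt-+n (suc κ + l))
    ... | e , e∈ , _ , _ , right (left outer) , j =
      t-unique (suc (κ + p)) {0} {p + r} (trans (sym (+-suc p r)) pr) e∈
        (joins-sym e (subst₂ (Joins e) (cong pt (middle-lo κ m p r)) hi≡ j))
      where
      hi≡ : pt (suc κ + m + suc r + (p + p) + 1) ≡ pt (suc (suc (κ + p)) + 0)
      hi≡ = trans (cong pt (subst (λ m → suc κ + m + suc r + (p + p) + 1 ≡ suc (suc (κ + p)) + 0 + 2 * m) pr
              (middle-hi κ p r))) (pt-+n (suc (suc (κ + p)) + 0))
    ... | e , e∈ , _ , _ , right (right arc) , j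
      with i , l , refl , refl , refl ← rainbow-arc r arc =
      ⊥-elim (<⇒≱ (s≤s (m≤m+n p i)) (≤-trans (≤-reflexive (sym (t-unique (suc κ) (trans (last-size p i l) pr) e∈
        (subst₂ (Joins e) lo≡ hi≡ j)))) ≤p))
      where
      lo≡ : pt (suc κ + m + suc (suc (i + l)) + (p + p) + 2 + i) ≡ pt (suc (suc κ) + suc (p + i))
      lo≡ = trans (cong pt (subst (λ m → suc κ + m + suc (suc (i + l)) + (p + p) + 2 + i ≡ suc (suc κ) + suc (p + i) + 2 * m) pr
              (last-lo κ p (suc (i + l)) i))) (pt-+n (suc (suc κ) + suc (p + i)))
      hi≡ : pt (suc κ + m + suc (suc (i + l)) + (p + p) + 2 + suc (i + l) + l) ≡ pt (suc (suc κ) + m + l)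
      hi≡ = trans (cong pt (subst (λ m → suc κ + m + suc (suc (i + l)) + (p + p) + 2 + suc (i + l) + l ≡ suc (suc κ) + m + l + 2 * m) pr
              (last-hi κ p (suc (i + l)) l))) (pt-+n (suc (suc κ) + m + l))

  walkable-meets : ∀ {B C} → Blocking B → length B ≡ m → Walkable C → Meets C B
  walkable-meets {B} {C} blocking len walkable with Any.any? (_∈? B) C
    where open DecMembership _≟ᵉ_ using (_∈?_)
  ... | yes any = find any
  ... | no none = ⊥-elim (Profile.walk-meets-profile m t antipode turn τ
        (λ v → proj₁ (proj₂ (proj₂ (spoke v))))
        (λ v → let _ , _ , p , e∈ , j = spoke v
                   _ , _ , q , f∈ , j′ = spoke (suc v) in step e∈ f∈ p q j j′)
        avoid)
    where
    open Minimum blocking len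
    open Walkable walkable
    τ : ℕ → ℕ
    τ v = proj₁ (spoke v)
    avoid : ∀ v → t (v + τ v) ≢ τ v
    -- With equal depths the blocker's chord in the class of v + τ(v) is the spoke itself.
    avoid v eq with e , _ , e∈ , j ← proj₂ (spoke v) with f , f∈ , j′ ← chord∈ (v + τ v) =
      none (lose e∈ (subst (_∈ B) (joins-unique f e (joins-sym f j″) j) f∈))
      where
      j″ : Joins f (pt (v + suc (τ v + τ v))) (pt v)
      j″ = subst₂ (Joins f)
        (cong pt (trans (cong (suc (v + τ v) +_) eq) (spoke-end v (τ v))))
        (trans (cong pt (trans (cong (λ m → suc (v + τ v) + m + s (v + τ v)) m≡)
                               (trans (antipodal-spoke v (τ v) (s (v + τ v))) (cong (λ m → v + 2 * m) (sym m≡)))))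
               (pt-+n v)) j′
        where
        m≡ : m ≡ suc (τ v + s (v + τ v))
        m≡ = trans (sym (t+s (v + τ v))) (cong (λ x → suc (x + s (v + τ v))) eq)

  -- Double stars as blockers

  -- The double star on the boundary edge [w , w+1]: one edge in each odd direction, the first k + 1
  -- of them at w + 1 and the others at w. For k = 0 this is the star of w.
  module DoubleStar (w k : ℕ) where

    Ray : ℕ → Edge n → Set
    Ray j e = (j ≤ k × Joins e (pt (suc w)) (pt (w + (j + j)))) ⊎ (k < j × Spoke w j e)

    ray : ∀ j → j < m → ∃ (Ray j)
    ray j j<m with j ≤? k
    ... | yes j≤k = let e , p = chord (pt (suc w)) (pt (w + (j + j)))
                          (λ eq → odd≢even 0 j (pt-window w 1<n (2*<n j<m) (trans (cong pt (+-comm w 1)) eq)))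
                    in e , inj₁ (j≤k , p)
    ... | no j≰k  = let e , p = chord (pt w) (pt (w + suc (j + j)))
                          (λ eq → 0≢1+n (pt-window w (<-trans z<s 1<n) (odd<n j<m) (trans (cong pt (+-identityʳ w)) eq)))
                    in e , inj₂ (≰⇒> j≰k , p)

    -- Rays of equal index at w and at w + 1 are parallel, so the m rays have distinct directions
    -- wherever the centre switches.
    ray-direction : ∀ j e → Ray j e → sum e % n ≡ (suc (w + w) + (j + j)) % n
    ray-direction j e (inj₁ (_ , p)) = trans (sum-joins e {suc w} {w + (j + j)} p) (cong (_% n) (near-sum w j))
    ray-direction j e (inj₂ (_ , p)) = trans (sum-joins e {w} {w + suc (j + j)} p) (cong (_% n) (far-sum w j))

    private
      rayᶠ : Fin m → Edge n
      rayᶠ i = proj₁ (ray (toℕ i) (Fin.toℕ<n i))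

      rayᶠ-ray : ∀ i → Ray (toℕ i) (rayᶠ i)
      rayᶠ-ray i = proj₂ (ray (toℕ i) (Fin.toℕ<n i))

    abstract

      rays : EdgeSet n
      rays = tabulate rayᶠ

      rays-unique : Unique rays
      rays-unique = Unique.tabulate⁺ λ {i} {j} eq → Fin.toℕ-injective (double-injective
        (%-window (suc (w + w)) (2*<n (Fin.toℕ<n i)) (2*<n (Fin.toℕ<n j))
          (trans (sym (ray-direction (toℕ i) (rayᶠ i) (rayᶠ-ray i)))
                 (trans (cong (λ e → sum e % n) eq) (ray-direction (toℕ j) (rayᶠ j) (rayᶠ-ray j))))))

      length-rays : length rays ≡ m
      length-rays = length-tabulate rayᶠ

      ∈-rays : ∀ {e} → e ∈ rays → ∃ λ j → j < m × Ray j e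
      ∈-rays e∈ with i , refl ← ∈-tabulate⁻ e∈ = toℕ i , Fin.toℕ<n i , rayᶠ-ray i

      rays-∋ : ∀ j → j < m → ∃ λ e → e ∈ rays × Ray j e
      rays-∋ j j<m = rayᶠ i , ∈-tabulate⁺ i , subst (λ j → Ray j (rayᶠ i)) (Fin.toℕ-fromℕ< j<m) (rayᶠ-ray i)
        where
        i : Fin m
        i = fromℕ< j<m

      -- The edge of M at w is a ray if τ > k, and also if τ = 0, being then the boundary edge.
      -- Otherwise the edge at w + 1 has τ′ < τ ≤ k and is the ray of index τ′ + 1.
      rays-meet : ∀ {M} → Walkable M → Meets rays M
      rays-meet {M} walkable
        with τ , e , τ<m , e∈ , j ← Walkable.spoke walkable w with k <? τ
      rays-meet {M} walkable | yes k<τ with rays-∋ τ τ<m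
      ... | r , r∈ , inj₁ (τ≤k , _) = ⊥-elim (<⇒≱ k<τ τ≤k)
      ... | r , r∈ , inj₂ (_ , j′)  = r , r∈ , subst (_∈ M) (joins-unique e r j j′) e∈
      rays-meet {M} walkable | no k≮τ
        with τ′ , f , τ′<m , f∈ , j′ ← Walkable.spoke walkable (suc w)
        with Walkable.step walkable e∈ f∈ τ<m τ′<m j j′
      ... | inj₁ refl with rays-∋ 0 τ<m
      ...   | r , r∈ , inj₁ (_ , j″) = r , r∈ , subst (_∈ M) (joins-unique e r j (joins-sym r
                (subst₂ (Joins r) (cong pt (sym (+-comm w 1))) (cong pt (+-identityʳ w)) j″))) e∈
      rays-meet {M} walkable | no k≮τ | inj₂ τ′<τ with rays-∋ (suc τ′) (≤-trans (s≤s τ′<τ) τ<m)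
      ...   | r , r∈ , inj₁ (_ , j″) = r , r∈ , subst (_∈ M) (joins-unique f r
                (subst (λ x → Joins f (pt (suc w)) (pt x)) (next-odd w τ′) j′) j″) f∈
      ...   | r , r∈ , inj₂ (k<τ′+1 , _) = ⊥-elim (k≮τ (≤-trans k<τ′+1 τ′<τ))

      rays-blocker : IsBlocker m rays
      rays-blocker = rays-unique , (λ S spm → rays-meet (spm-walkable spm)) ,
        λ B _ blocking → ≤-trans (≤-reflexive length-rays) (Directions.k≤length B blocking)

  -- Bounded below by the parallel classes and above by the star of vertex 0.
  blocker-length : ∀ {B} → IsBlocker m B → length B ≡ m
  blocker-length {B} (_ , blocking , minimal) = ≤-antisym
    (≤-trans (minimal rays rays-unique (λ S spm → rays-meet (spm-walkable spm))) (≤-reflexive length-rays))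
    (Directions.k≤length B blocking)
    where open DoubleStar 0 0

  -- Stars and co-blockers

  MeetsBlockers : EdgeSet n → Set
  MeetsBlockers C = ∀ B → IsBlocker m B → Meets C B

  OnStar : ℕ → Edge n → Set
  OnStar v e = ∃ λ τ → τ < m × Spoke v τ e

  star-hit : ∀ C → MeetsBlockers C → ∀ v → ∃ λ e → e ∈ C × OnStar v e
  star-hit C meets v with e , e∈C , e∈star ← meets (DoubleStar.rays v 0) (DoubleStar.rays-blocker v 0)
                   with DoubleStar.∈-rays v 0 e∈star
  ... | j , j<m , inj₂ (_ , s)        = e , e∈C , j , j<m , s
  -- Ray 0 is centred at v + 1, but as the boundary edge [v , v+1] it is a spoke of v too.
  ... | .0 , j<m , inj₁ (z≤n , s) = e , e∈C , 0 , j<m , joins-sym e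
        (subst₂ (Joins e) (cong pt (sym (+-comm v 1))) (cong pt (+-identityʳ v)) s)

  -- The edges of odd order at v + 2i and at v + 2j are different, as their other ends have the
  -- opposite parity.
  stars-disjoint : ∀ v (i j : Fin m) e → OnStar (v + (toℕ i + toℕ i)) e → OnStar (v + (toℕ j + toℕ j)) e → i ≡ j
  stars-disjoint v iᶠ jᶠ e (τ , τ<m , s) (τ′ , τ′<m , s′)
    with incident-either e s (joins⇒incident e s′)
  ... | inj₁ eq = Fin.toℕ-injective (double-injective
        (pt-window v (2*<n (Fin.toℕ<n iᶠ)) (2*<n (Fin.toℕ<n jᶠ)) (sym eq)))
  ... | inj₂ eq = ⊥-elim (0≢1+n (begin
    0                                     ≡⟨ %2-+ 0 j ⟨
    (j + j) % 2                           ≡⟨ same (j + j) (i + i + suc (τ + τ)) (trans eq (cong pt (+-assoc v (i + i) _))) ⟩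
    (i + i + suc (τ + τ)) % 2             ≡⟨ cong (_% 2) (+-comm (i + i) (suc (τ + τ))) ⟩
    (suc (τ + τ) + (i + i)) % 2           ≡⟨ %2-+ (suc (τ + τ)) i ⟩
    suc (τ + τ) % 2                       ≡⟨ %2-+ 1 τ ⟩
    1                                     ∎))
    where
    open ≡-Reasoning
    i = toℕ iᶠ
    j = toℕ jᶠ
    same : ∀ x y → pt (v + x) ≡ pt (v + y) → x % 2 ≡ y % 2
    same x y eq = begin
      x % 2                 ≡⟨ %2-+ x v ⟨
      (x + (v + v)) % 2     ≡⟨ cong (_% 2) (around x v) ⟨
      (v + (v + x)) % 2     ≡⟨ %-distribˡ-+ v (v + x) 2 ⟩
      (v % 2 + (v + x) % 2) % 2 ≡⟨ cong (λ r → (v % 2 + r) % 2) (pt-parity eq) ⟩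
      (v % 2 + (v + y) % 2) % 2 ≡⟨ %-distribˡ-+ v (v + y) 2 ⟨
      (v + (v + y)) % 2     ≡⟨ cong (_% 2) (around y v) ⟩
      (y + (v + v)) % 2     ≡⟨ %2-+ y v ⟩
      y % 2                 ∎

  -- The stars at v, v + 2, ..., v + 2(m - 1) are disjoint blockers, which forces m edges; a free v
  -- reaches both parities.
  module Stars C (meets : MeetsBlockers C) (v : ℕ) =
    Packing (λ i → OnStar (v + (toℕ i + toℕ i))) (stars-disjoint v) C (λ i → star-hit C meets (v + (toℕ i + toℕ i)))

  coherent⇒coblocker : ∀ {C} → Unique C → IsPerfectMatching m C → All OddOrder C → NoAdjacentCrossing C → IsCoBlocker m C
  coherent⇒coblocker {C} uniq pm@(_ , len , _) odd nac = uniq ,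
    (λ B blocker → walkable-meets (proj₁ (proj₂ blocker)) (blocker-length blocker) (coherent-walkable pm odd nac)) ,
    λ C′ _ meets → ≤-trans (≤-reflexive len) (Stars.k≤length C′ meets 0)

  module CoBlocker {C} (coblocker : IsCoBlocker m C) where

    private
      meets : MeetsBlockers C
      meets = proj₁ (proj₂ coblocker)

    -- A simple perfect matching meets all blockers with m edges, which bounds C from above.
    length≡m : length C ≡ m
    length≡m with S , (uniq , len , disj) , _ ← spm-of (rainbow m) refl 0 = ≤-antisym
      (≤-trans (proj₂ (proj₂ coblocker) S uniq
        (λ B blocker → let e , e∈B , e∈S = proj₁ (proj₂ blocker) S (uniq , len , disj) in e , e∈S , e∈B)) (≤-reflexive len))
      (Stars.k≤length C meets 0)

    -- As the bound is attained, every edge of C lies on the star of some even vertex, and stars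
    -- contain odd edges only.
    odd : ∀ {e} → e ∈ C → OddOrder e
    odd {e} e∈ with i , (τ , _ , s) , _ ← Stars.class-of C meets 0 length≡m e∈ = spoke-odd e {v = toℕ i + toℕ i} {τ} s

    star-unique : ∀ v {e f} → e ∈ C → f ∈ C → OnStar v e → OnStar v f → e ≡ f
    star-unique v {e} {f} e∈ f∈ p q = Stars.unique-hit C meets v length≡m {i = i₀} e∈ f∈ (move e p) (move f q)
      where
      i₀ : Fin m
      i₀ = fromℕ< (>-nonZero⁻¹ m)
      v≡ : v ≡ v + (toℕ i₀ + toℕ i₀)
      v≡ = trans (sym (+-identityʳ v)) (cong (λ x → v + (x + x)) (sym (Fin.toℕ-fromℕ< (>-nonZero⁻¹ m))))
      move : ∀ e → OnStar v e → OnStar (v + (toℕ i₀ + toℕ i₀)) e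
      move e = subst (λ x → OnStar x e) v≡

    incident-unique : ∀ v {e f} → e ∈ C → f ∈ C → Incident (pt v) e → Incident (pt v) f → e ≡ f
    incident-unique v {e} {f} e∈ f∈ ve vf = star-unique v e∈ f∈ (odd⇒spoke e v (odd e∈) ve) (odd⇒spoke f v (odd f∈) vf)

    perfect : IsPerfectMatching m C
    perfect = proj₁ coblocker , length≡m , λ v → let e , e∈ , τ , _ , s = star-hit C meets (toℕ v) in
      e , e∈ , subst (λ x → Incident x e) (pt-toℕ v) (joins⇒incident e s) , λ f f∈ vf →
      incident-unique (toℕ v) f∈ e∈ (subst (λ x → Incident x f) (sym (pt-toℕ v)) vf) (joins⇒incident e s)

    -- If the edges of C at w and w + 1 cross, the double star on [w , w+1] that switches centre
    -- just after the direction of the first one avoids both.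
    no-crossing : ∀ w {e f} → e ∈ C → f ∈ C → Incident (pt w) e → Incident (pt (suc w)) f → ¬ Cross e f
    no-crossing w {e} {f} e∈ f∈ we wf x =
      let τ , τ<m , s = odd⇒spoke e w (odd e∈) we
          g , g∈C , g∈ = meets (DoubleStar.rays w τ) (DoubleStar.rays-blocker w τ)
          j , j<m , r = DoubleStar.∈-rays w τ g∈
      in avoid τ τ<m s j j<m g g∈C r
      where
      nested : ∀ τ → τ < m → Spoke w τ e → ∀ j → j ≤ τ → Joins f (pt (suc w)) (pt (w + (j + j))) → ⊥
      nested τ τ<m s zero _ s′ = cross⇒¬share e f x (pt w , we ,
        joins⇒incident f (joins-sym f (subst (Joins f (pt (suc w))) (cong pt (+-identityʳ w)) s′)))
      nested τ τ<m s (suc j) j≤τ s′ = nested⇒¬cross e f (n<1+n w)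
        (≤-trans (≤-reflexive (sym (+-comm w 2))) (+-monoʳ-≤ w (s≤s (≤-trans (s≤s z≤n) (m≤n+m (suc j) j)))))
        (+-monoʳ-< w (s≤s (+-mono-≤ j≤τ j≤τ))) (+-monoʳ-< w (odd<n τ<m)) s s′ x
      avoid : ∀ τ → τ < m → Spoke w τ e → ∀ j → j < m → ∀ g → g ∈ C → DoubleStar.Ray w τ j g → ⊥
      -- A ray at w + 1 lying in C is f, and for j ≤ τ it is nested in e or meets e at w. A ray at w
      -- lying in C is e, which would force j = τ.
      avoid τ τ<m s j j<m g g∈C (inj₁ (j≤τ , s′)) = nested τ τ<m s j j≤τ
        (subst (λ g → Joins g (pt (suc w)) (pt (w + (j + j))))
               (incident-unique (suc w) g∈C f∈ (joins⇒incident g s′) wf) s′)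
      avoid τ τ<m s j j<m g g∈C (inj₂ (τ<j , s′)) =
        <⇒≢ τ<j (sym (double-injective (suc-injective (pt-window w (odd<n j<m) (odd<n τ<m) (joins-other e
          (subst (Spoke w j) (incident-unique w g∈C e∈ (joins⇒incident g s′) we) s′) s)))))

    coherent : NoAdjacentCrossing C
    coherent e f e∈ f∈ a b a′ c je jf adj x with adjacent⇒suc a a′ adj
    ... | inj₁ refl = no-crossing (toℕ a) e∈ f∈ (subst (λ v → Incident v e) (sym (pt-toℕ a)) (joins⇒incident e je)) (joins⇒incident f jf) x
    ... | inj₂ refl = no-crossing (toℕ a′) f∈ e∈ (subst (λ v → Incident v f) (sym (pt-toℕ a′)) (joins⇒incident f jf))
                        (joins⇒incident e je) (cross-sym e f x)

no-edges : (C : EdgeSet 0) → C ≡ []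
no-edges []      = refl
no-edges (e ∷ _) with lo e
... | ()

theorem1 : (m : ℕ) (C : EdgeSet (2 * m)) → Unique C →
    IsCoBlocker m C ⇔ (IsPerfectMatching m C × All OddOrder C × NoAdjacentCrossing C)
theorem1 zero C _ with refl ← no-edges C = mk⇔
  (λ _ → ([] , refl , λ ()) , [] , λ _ _ ())
  -- For m = 0 the empty set is a simple perfect matching that nothing meets, so there are no
  -- blockers and the condition on them is vacuous.
  (λ _ → [] , (λ { B (_ , blocking , _) → let _ , _ , e∈ = blocking [] ([] , refl , []) in ⊥-elim (∉[] e∈) }) , λ _ _ _ → z≤n)
  where
  ∉[] : ∀ {e : Edge 0} → ¬ e ∈ []
  ∉[] ()
theorem1 m@(suc _) C uniq = mk⇔
  (λ coblocker → Polygon.CoBlocker.perfect m coblocker , All.tabulate (Polygon.CoBlocker.odd m coblocker) ,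
                 Polygon.CoBlocker.coherent m coblocker)
  (λ { (pm , odd , nac) → Polygon.coherent⇒coblocker m uniq pm odd nac })
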